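{- Let $n$ be any positive integer and let $G$ be a graph cospectral with the friendship graph $F_n$. If $G$ has no cycle of length $4$ or $5$, then $G$ is isomorphic to $F_n$. Moreover, if $G$ does not have $C_4$ or induced $C_4$ (that is, $G$ does not have the cycle $C_4$ as a subgraph, or does not have $C_4$ as an induced subgraph), then $G$ is isomorphic to $F_n$.
   Context: All graphs are finite, simple and undirected. The friendship graph $F_n$ ($n\ge 1$) is the graph with $2n+1$ vertices and $3n$ edges obtained from $n$ copies of the triangle $C_3$ by identifying one vertex of each copy into a single common vertex. Two graphs are cospectral if their $(0,1)$-adjacency matrices have the same multiset of eigenvalues. $C_4$ denotes the cycle of length $4$. -}

module Defs where

open import Algebra.Apartness.Bundles using (HeytingField; HeytingCommutativeRing)
open import Algebra.Bundles using (CommutativeRing)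
import Algebra.Definitions.RawMonoid as RawMonoidDefs
open import Data.Bool.Base using (if_then_else_)
open import Data.Empty using (⊥)
open import Data.Fin.Base using (Fin; zero; suc; toℕ; quotient)
open import Data.Fin.Properties using (_≟_; toℕ<n)
open import Data.List.Base using (tabulate)
import Data.List.Relation.Binary.Permutation.Setoid as PermutationSetoid
open import Data.Nat.Base using (ℕ; suc; _+_; _*_; _%_)
open import Data.Nat.DivMod using (m<n⇒m%n≡m; n%n≡0)
import Data.Nat.Properties as ℕ
open import Data.Product.Base using (Σ-syntax; _×_; _,_)
open import Data.Sum.Base using (_⊎_; inj₁; inj₂; swap; [_,_])
open import Data.Unit.Base using (⊤; tt)
open import Function.Base using (id; _∘_)
open import Function.Bundles using (_↔_; _⇔_; Inverse)
open import Function.Definitions using (Injective)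
open import Level using (0ℓ; _⊔_)
open import Relation.Binary.Core using (Rel)
open import Relation.Binary.Definitions using (Decidable; Irreflexive; Symmetric)
open import Relation.Binary.PropositionalEquality
  using (_≡_; _≢_; refl; sym; trans; cong)
open import Relation.Nullary.Decidable using (yes; no; ⌊_⌋; _×-dec_; _⊎-dec_; ¬?)
open import Relation.Nullary.Negation using (¬_)

record Graph : Set₁ where
  infix 4 _~_ _~?_
  field
    order    : ℕ
    _~_      : Rel (Fin order) 0ℓ
    _~?_     : Decidable _~_
    ~-irrefl : Irreflexive _≡_ _~_
    ~-sym    : Symmetric _~_

  Vertex : Set
  Vertex = Fin order

open Graph using (order; Vertex)

infix 4 _≅_

_≅_ : Graph → Graph → Set
G ≅ H = Σ[ f ∈ (Vertex G ↔ Vertex H) ]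
        (∀ u v → u G.~ v ⇔ (Inverse.to f u H.~ Inverse.to f v))
  where module G = Graph G
        module H = Graph H

HasSubgraph : Graph → Graph → Set
HasSubgraph G H = Σ[ f ∈ (Vertex H → Vertex G) ]
  (Injective _≡_ _≡_ f × (∀ u v → u H.~ v → f u G.~ f v))
  where module G = Graph G
        module H = Graph H

HasInducedSubgraph : Graph → Graph → Set
HasInducedSubgraph G H = Σ[ f ∈ (Vertex H → Vertex G) ]
  (Injective _≡_ _≡_ f × (∀ u v → u H.~ v ⇔ (f u G.~ f v)))
  where module G = Graph G
        module H = Graph H

-- The cycle of length 3 + k: i and j are adjacent iff they differ by one
-- modulo 3 + k.
C₃₊ : ℕ → Graph
C₃₊ k = record
  { order    = 3 + k
  ; _~_      = λ i j → Next i j ⊎ Next j i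
  ; _~?_     = λ i j → (toℕ j ℕ.≟ suc (toℕ i) % (3 + k))
                       ⊎-dec (toℕ i ℕ.≟ suc (toℕ j) % (3 + k))
  ; ~-irrefl = λ { {i} refl → [ irr i , irr i ] }
  ; ~-sym    = swap
  }
  where
  Next : Rel (Fin (3 + k)) 0ℓ
  Next i j = toℕ j ≡ suc (toℕ i) % (3 + k)

  irr : ∀ i → ¬ Next i i
  irr i i≡ with ℕ.m≤n⇒m<n∨m≡n (toℕ<n i)
  ... | inj₁ lt = ℕ.1+n≢n (sym (trans i≡ (m<n⇒m%n≡m lt)))
  ... | inj₂ eq with trans (sym (ℕ.suc-injective eq))
                       (trans i≡ (trans (cong (_% (3 + k)) eq) (n%n≡0 (3 + k))))
  ...   | ()

C₄ C₅ : Graph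
C₄ = C₃₊ 1
C₅ = C₃₊ 2

-- Vertex zero is the common vertex of the n triangles.  The other 2n vertices
-- are numbered so that  quotient 2  gives the triangle a vertex belongs to.
F : ℕ → Graph
F n = record
  { order    = suc (n * 2)
  ; _~_      = _~_
  ; _~?_     = _~?_
  ; ~-irrefl = λ { {zero} refl () ; {suc i} refl (i≢i , _) → i≢i refl }
  ; ~-sym    = λ {i} {j} → ~-sym i j
  }
  where
  _~_ : Rel (Fin (suc (n * 2))) 0ℓ
  zero  ~ zero  = ⊥
  zero  ~ suc _ = ⊤
  suc _ ~ zero  = ⊤
  suc i ~ suc j = i ≢ j × quotient {n} 2 i ≡ quotient {n} 2 j

  _~?_ : Decidable _~_
  zero  ~? zero  = no id
  zero  ~? suc _ = yes tt
  suc _ ~? zero  = yes tt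
  suc i ~? suc j = ¬? (i ≟ j) ×-dec (quotient {n} 2 i ≟ quotient {n} 2 j)

  ~-sym : ∀ i j → i ~ j → j ~ i
  ~-sym zero    (suc _) _         = tt
  ~-sym (suc _) zero    _         = tt
  ~-sym (suc i) (suc j) (i≢j , q) = i≢j ∘ sym , sym q

-- The library has no real numbers, so eigenvalues are taken in an arbitrary
-- (Heyting) field K of characteristic zero; the real numbers are an instance.
module _ {c ℓ₁ ℓ₂} (K : HeytingField c ℓ₁ ℓ₂) where
  open HeytingField K
    using (Carrier; _≈_; _#_; 0#; 1#)
    renaming (_*_ to _·_; heytingCommutativeRing to hcr)
  open CommutativeRing (HeytingCommutativeRing.commutativeRing hcr)
    using (+-commutativeMonoid; +-rawMonoid; setoid)
  open import Algebra.Properties.CommutativeMonoid.Sum +-commutativeMonoid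
    using (sum)
  open RawMonoidDefs +-rawMonoid using () renaming (_×_ to _times_)
  open PermutationSetoid setoid using (_↭_)

  CharacteristicZero : Set ℓ₂
  CharacteristicZero = ∀ n → (suc n times 1#) # 0#

  Matrix : ℕ → Set c
  Matrix m = Fin m → Fin m → Carrier

  infix  4 _≈ᴹ_
  infixl 7 _*ᴹ_

  _≈ᴹ_ : ∀ {m} → Matrix m → Matrix m → Set ℓ₁
  A ≈ᴹ B = ∀ i j → A i j ≈ B i j

  _*ᴹ_ : ∀ {m} → Matrix m → Matrix m → Matrix m
  (A *ᴹ B) i j = sum (λ k → A i k · B k j)

  diagonal : ∀ {m} → (Fin m → Carrier) → Matrix m
  diagonal d i j = if ⌊ i ≟ j ⌋ then d i else 0#

  identity : ∀ {m} → Matrix m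
  identity = diagonal (λ _ → 1#)

  adjacencyMatrix : (G : Graph) → Matrix (order G)
  adjacencyMatrix G u v = if ⌊ u G.~? v ⌋ then 1# else 0#
    where module G = Graph G

  -- The family d lists the eigenvalues of A with multiplicity: the columns of
  -- P form a basis of Kᵐ, and column j is an eigenvector for d j.  Every real
  -- symmetric matrix has such a family, unique up to order.
  IsEigenvalueFamily : ∀ {m} → Matrix m → (Fin m → Carrier) → Set (c ⊔ ℓ₁)
  IsEigenvalueFamily {m} A d = Σ[ P ∈ Matrix m ] Σ[ Q ∈ Matrix m ]
    (P *ᴹ Q ≈ᴹ identity × Q *ᴹ P ≈ᴹ identity ×
     (∀ i j → (A *ᴹ P) i j ≈ d j · P i j))

  Cospectral : Graph → Graph → Set (c ⊔ ℓ₁)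
  Cospectral G H =
    Σ[ d ∈ (Vertex G → Carrier) ] Σ[ e ∈ (Vertex H → Carrier) ]
    (IsEigenvalueFamily (adjacencyMatrix G) d ×
     IsEigenvalueFamily (adjacencyMatrix H) e ×
     tabulate d ↭ tabulate e)

{-# OPTIONS --safe #-}
module Submission where

-- Let A be the adjacency matrix of G and B = A² - I.  A common spectrum with
-- F n makes A similar to the adjacency matrix of F n, so B is a positive
-- semidefinite matrix of rank two (rank one if n = 1): the Gram matrix of plane
-- vectors, one for each vertex, with |u|² = deg u - 1 and u · v equal to the
-- number of common neighbours.  On this plane A acts with trace 1 and
-- A² = A + 2n.
--
-- Suppose an edge u v with both degrees at least two is in no triangle.  Then
-- u ⟂ v, and the inner products with u and v determine all others.  Without
-- C₅, or without induced C₄, the neighbours of u and v then have inner products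
-- that contradict the trace condition.  So every such edge is in a triangle.
--
-- By the trace condition, no two nonzero vectors are now orthogonal.  Row u of
-- A² B - A B = 2n B writes 2n u as the combination of the vectors z with
-- nonnegative coefficients (A² - A)_uz.  If u is on an extreme ray of the cone,
-- all z off this ray have coefficient zero, that is, u and z are adjacent with
-- exactly one common neighbour.  Applying this to both extreme rays, one of them
-- carries a single vertex, which has degree 2n and exactly one common neighbour
-- with each other vertex.  It is the centre of F n.

open import Defs
open import Algebra.Apartness.Bundles using (HeytingField; HeytingCommutativeRing)
open import Algebra.Bundles using (CommutativeRing)
import Algebra.Solver.Ring as RingSolver
open import Algebra.Solver.Ring.AlmostCommutativeRing using (_-Raw-AlmostCommutative⟶_; fromCommutativeRing)
open import Data.Bool.Base using (if_then_else_)
open import Data.Empty using (⊥)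
open import Data.Fin.Base using (Fin; zero; suc; cast; punchIn; punchOut; quotient; toℕ)
open import Data.Fin.Patterns using (0F; 1F; 2F; 3F; 4F)
open import Data.Fin.Permutation as Perm using (Permutation; _⟨$⟩ʳ_; _⟨$⟩ˡ_; _∘ₚ_; cast-id)
open import Data.Fin.Properties
  using (_≟_; any?; all?; cast-involutive; injective⇒≤; punchIn-punchOut; suc-injective; toℕ-injective)
open import Data.Integer.Base as ℤ using (ℤ; +_; -[1+_])
import Data.Integer.Properties as ℤ
import Data.Integer.Tactic.RingSolver as ℤRing
import Data.List.Base as List
open import Data.List.Properties using (length-tabulate; lookup-tabulate)
import Data.List.Relation.Binary.Permutation.Setoid as ListPermutation
import Data.List.Relation.Binary.Permutation.Setoid.Properties as Permutationₚ
import Data.Maybe.Base as Maybe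
open import Data.Nat.Base as ℕ using (ℕ; zero; suc; z≤n; s≤s; NonZero)
import Data.Nat.Properties as ℕ
open import Data.Product.Base using (_×_; _,_; proj₁; proj₂; ∃-syntax)
open import Data.Sum.Base using (_⊎_; inj₁; inj₂; [_,_])
open import Data.Unit.Base using (tt)
open import Function.Base using (_∘_; id)
open import Function.Bundles using (Equivalence; mk⇔; mk↔ₛ′)
open import Function.Definitions using (Injective)
open import Level using (_⊔_)
open import Relation.Binary.PropositionalEquality as ≡ using (_≡_; _≢_)
open import Relation.Nullary.Decidable using (Dec; yes; no; ⌊_⌋; dec⇒maybe; decidable-stable; _×-dec_; ¬?)
open import Relation.Nullary.Negation using (¬_; contradiction)

-- Integers inside a commutative ring

module IntegerImage {c ℓ} (R : CommutativeRing c ℓ) where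
  open CommutativeRing R hiding (zero)
  open import Algebra.Properties.Ring ring
  open import Algebra.Properties.AbelianGroup +-abelianGroup using (⁻¹-∙-comm)
  open import Algebra.Properties.Semiring.Mult semiring
    using (×-homo-+; ×1-homo-*; ×-congˡ) renaming (_×_ to _times_)
  open import Relation.Binary.Reasoning.Setoid setoid

  -- The canonical ring homomorphism. It supplies the integer coefficients of the ring solver and
  -- later carries the integer matrices of a graph into the field.
  ι : ℤ → Carrier
  ι (+ n)    = n times 1#
  ι -[1+ n ] = - (suc n times 1#)

  ι-cong : ∀ {i j} → i ≡ j → ι i ≈ ι j
  ι-cong ≡.refl = refl

  ι-neg : ∀ i → ι (ℤ.- i) ≈ - ι i
  ι-neg (+ zero)  = sym -0#≈0#
  ι-neg (+ suc n) = refl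
  ι-neg -[1+ n ]  = sym (-‿involutive _)

  -- A sum of integers of opposite signs computes to `ℤ.⊖`, so this is the part of `ι-+` that has
  -- content.
  ι-⊖ : ∀ m n → ι (m ℤ.⊖ n) ≈ m times 1# - n times 1#
  ι-⊖ m zero = begin
    ι (m ℤ.⊖ 0)      ≈⟨ ι-cong (ℤ.⊖-≥ (ℕ.z≤n {m})) ⟩
    m times 1#         ≈⟨ +-identityʳ _ ⟨
    m times 1# + 0#    ≈⟨ +-congˡ -0#≈0# ⟨
    m times 1# - 0#    ∎
  ι-⊖ zero (suc n) = begin
    - (suc n times 1#)      ≈⟨ +-identityˡ _ ⟨
    0# - suc n times 1#     ∎
  ι-⊖ (suc m) (suc n) = begin
    ι (suc m ℤ.⊖ suc n)                  ≈⟨ ι-cong (ℤ.[1+m]⊖[1+n]≡m⊖n m n) ⟩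
    ι (m ℤ.⊖ n)                          ≈⟨ ι-⊖ m n ⟩
    m times 1# - n times 1#                    ≈⟨ +-identityˡ _ ⟨
    0# + (m times 1# - n times 1#)             ≈⟨ +-congʳ (-‿inverseʳ 1#) ⟨
    (1# - 1#) + (m times 1# - n times 1#)      ≈⟨ +-assoc _ _ _ ⟩
    1# + (- 1# + (m times 1# - n times 1#))    ≈⟨ +-congˡ (+-assoc _ _ _) ⟨
    1# + ((- 1# + m times 1#) - n times 1#)    ≈⟨ +-congˡ (+-congʳ (+-comm _ _)) ⟩
    1# + ((m times 1# - 1#) - n times 1#)      ≈⟨ +-congˡ (+-assoc _ _ _) ⟩
    1# + (m times 1# + (- 1# - n times 1#))    ≈⟨ +-assoc _ _ _ ⟨
    suc m times 1# + (- 1# - n times 1#)       ≈⟨ +-congˡ (⁻¹-∙-comm _ _) ⟩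
    suc m times 1# - suc n times 1#            ∎

  ι-+ : ∀ i j → ι (i ℤ.+ j) ≈ ι i + ι j
  ι-+ (+ m)    (+ n)    = ×-homo-+ 1# m n
  ι-+ (+ m)    -[1+ n ] = ι-⊖ m (suc n)
  ι-+ -[1+ m ] (+ n)    = trans (ι-⊖ n (suc m)) (+-comm _ _)
  ι-+ -[1+ m ] -[1+ n ] = begin
    - (suc (suc (m ℕ.+ n)) times 1#)       ≈⟨ -‿cong (×-congˡ (≡.cong suc (≡.sym (ℕ.+-suc m n)))) ⟩
    - ((suc m ℕ.+ suc n) times 1#)         ≈⟨ -‿cong (×-homo-+ 1# (suc m) (suc n)) ⟩
    - (suc m times 1# + suc n times 1#)        ≈⟨ ⁻¹-∙-comm _ _ ⟨
    - (suc m times 1#) - suc n times 1#        ∎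

  private
    ι-pos-* : ∀ m j → ι (+ m ℤ.* j) ≈ ι (+ m) * ι j
    ι-pos-* m (+ n) = begin
      ι (+ m ℤ.* + n)          ≈⟨ ι-cong (≡.sym (ℤ.pos-* m n)) ⟩
      (m ℕ.* n) times 1#           ≈⟨ ×1-homo-* m n ⟩
      (m times 1#) * (n times 1#)      ∎
    ι-pos-* m -[1+ n ] = begin
      ι (+ m ℤ.* -[1+ n ])       ≈⟨ ι-cong (ℤ.neg-distribʳ-* (+ m) (+ suc n)) ⟨
      ι (ℤ.- (+ m ℤ.* + suc n))  ≈⟨ ι-neg (+ m ℤ.* + suc n) ⟩
      - ι (+ m ℤ.* + suc n)      ≈⟨ -‿cong (ι-pos-* m (+ suc n)) ⟩
      - (ι (+ m) * ι (+ suc n))  ≈⟨ -‿distribʳ-* _ _ ⟩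
      ι (+ m) * ι -[1+ n ]       ∎

  ι-* : ∀ i j → ι (i ℤ.* j) ≈ ι i * ι j
  ι-* (+ m)    j = ι-pos-* m j
  ι-* -[1+ m ] j = begin
    ι (-[1+ m ] ℤ.* j)         ≈⟨ ι-cong (ℤ.neg-distribˡ-* (+ suc m) j) ⟨
    ι (ℤ.- (+ suc m ℤ.* j))    ≈⟨ ι-neg (+ suc m ℤ.* j) ⟩
    - ι (+ suc m ℤ.* j)        ≈⟨ -‿cong (ι-pos-* (suc m) j) ⟩
    - (ι (+ suc m) * ι j)      ≈⟨ -‿distribˡ-* _ _ ⟩
    ι -[1+ m ] * ι j           ∎

  ι-1 : ι (+ 1) ≈ 1#
  ι-1 = +-identityʳ 1#

  ι-minus : ∀ i j → ι (i ℤ.- j) ≈ ι i - ι j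
  ι-minus i j = trans (ι-+ i (ℤ.- j)) (+-congˡ (ι-neg j))

  private
    ι-morphism : ℤ.+-*-rawRing -Raw-AlmostCommutative⟶ fromCommutativeRing R
    ι-morphism = record
      { ⟦_⟧ = ι ; +-homo = ι-+ ; *-homo = ι-* ; -‿homo = ι-neg
      ; 0-homo = refl ; 1-homo = ι-1 }

  open RingSolver ℤ.+-*-rawRing (fromCommutativeRing R) ι-morphism
    (λ i j → Maybe.map ι-cong (dec⇒maybe (i ℤ.≟ j))) public
    using (solve; con; _:=_; _:+_; _:*_; _:-_; :-_)

module _ {a p} {A : Set a} {P : Set p} {x y : A} where
  if-yes : (P? : Dec P) → P → (if ⌊ P? ⌋ then x else y) ≡ x
  if-yes (yes _) _ = ≡.refl
  if-yes (no ¬p) p = contradiction p ¬p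

  if-no : (P? : Dec P) → ¬ P → (if ⌊ P? ⌋ then x else y) ≡ y
  if-no (yes p) ¬p = contradiction p ¬p
  if-no (no _)  _  = ≡.refl

-- Matrix algebra over a commutative ring

module Matrices {c ℓ} (R : CommutativeRing c ℓ) where
  open CommutativeRing R hiding (zero)
  open import Algebra.Properties.Ring ring using (-0#≈0#; -‿distribˡ-*; -‿distribʳ-*)
  open import Algebra.Properties.AbelianGroup +-abelianGroup using (⁻¹-∙-comm)
  open import Algebra.Properties.Semiring.Sum semiring public
    using (sum; sum-cong-≋; sum-replicate-zero; ∑-distrib-+; ∑-comm;
           *-distribˡ-sum; *-distribʳ-sum; sum-remove)
  open import Relation.Binary.Reasoning.Setoid setoid

  infix  4 _≋_
  infixl 7 _⊗_
  infixl 6 _⊖_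

  Mat : ℕ → ℕ → Set c
  Mat m n = Fin m → Fin n → Carrier

  _≋_ : ∀ {m n} → Mat m n → Mat m n → Set ℓ
  A ≋ B = ∀ i j → A i j ≈ B i j

  _⊗_ : ∀ {m n o} → Mat m n → Mat n o → Mat m o
  (A ⊗ B) i j = sum (λ k → A i k * B k j)

  _⊖_ : ∀ {m n} → Mat m n → Mat m n → Mat m n
  (A ⊖ B) i j = A i j - B i j

  I : ∀ {m} → Mat m m
  I i j = if ⌊ i ≟ j ⌋ then 1# else 0#

  tr : ∀ {m} → Mat m m → Carrier
  tr A = sum (λ i → A i i)

  ≋-trans : ∀ {m n} {A B C : Mat m n} → A ≋ B → B ≋ C → A ≋ C
  ≋-trans e f i j = trans (e i j) (f i j)

  sum-cong : ∀ {m} {f g : Fin m → Carrier} → (∀ i → f i ≈ g i) → sum f ≈ sum g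
  sum-cong {f = f} {g} e = sum-cong-≋ {x = f} {y = g} e

  sum-neg : ∀ {m} (f : Fin m → Carrier) → sum (λ i → - f i) ≈ - sum f
  sum-neg {zero}  f = sym -0#≈0#
  sum-neg {suc m} f = trans (+-congˡ (sum-neg (f ∘ suc))) (⁻¹-∙-comm _ _)

  sum-minus : ∀ {m} (f g : Fin m → Carrier) → sum (λ i → f i - g i) ≈ sum f - sum g
  sum-minus f g = trans (∑-distrib-+ f (λ i → - g i)) (+-congˡ (sum-neg g))

  sum-zero : ∀ {m} {f : Fin m → Carrier} → (∀ i → f i ≈ 0#) → sum f ≈ 0#
  sum-zero {m} e = trans (sum-cong e) (sum-replicate-zero m)

  sum-single : ∀ {m} (f : Fin m → Carrier) i → (∀ k → k ≢ i → f k ≈ 0#) → sum f ≈ f i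
  sum-single f zero    e = trans (+-congˡ (sum-zero λ k → e (suc k) λ ())) (+-identityʳ _)
  sum-single f (suc i) e = trans
    (+-cong (e zero λ ()) (sum-single (f ∘ suc) i λ k k≢i → e (suc k) (k≢i ∘ suc-injective)))
    (+-identityˡ _)

  ⊗-cong : ∀ {m n o} {A A′ : Mat m n} {B B′ : Mat n o} → A ≋ A′ → B ≋ B′ → A ⊗ B ≋ A′ ⊗ B′
  ⊗-cong e f i j = sum-cong λ k → *-cong (e i k) (f k j)

  ⊗-congˡ : ∀ {m n o} (A : Mat m n) {B B′ : Mat n o} → B ≋ B′ → A ⊗ B ≋ A ⊗ B′
  ⊗-congˡ A = ⊗-cong {A = A} λ _ _ → refl

  ⊗-congʳ : ∀ {m n o} {A A′ : Mat m n} (B : Mat n o) → A ≋ A′ → A ⊗ B ≋ A′ ⊗ B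
  ⊗-congʳ B e = ⊗-cong {B = B} e λ _ _ → refl

  ⊗-assoc : ∀ {m n o p} (A : Mat m n) (B : Mat n o) (C : Mat o p) →
            (A ⊗ B) ⊗ C ≋ A ⊗ (B ⊗ C)
  ⊗-assoc A B C i j = begin
    sum (λ k → sum (λ l → A i l * B l k) * C k j)     ≈⟨ sum-cong (λ k → *-distribʳ-sum (C k j) λ l → A i l * B l k) ⟩
    sum (λ k → sum (λ l → A i l * B l k * C k j))     ≈⟨ ∑-comm (λ k l → A i l * B l k * C k j) ⟩
    sum (λ l → sum (λ k → A i l * B l k * C k j))     ≈⟨ sum-cong (λ l → sum-cong λ k → *-assoc (A i l) (B l k) (C k j)) ⟩
    sum (λ l → sum (λ k → A i l * (B l k * C k j)))   ≈⟨ sum-cong (λ l → *-distribˡ-sum (A i l) λ k → B l k * C k j) ⟨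
    sum (λ l → A i l * sum (λ k → B l k * C k j))     ∎

  ⊗-⊖-distribˡ : ∀ {m n o} (A : Mat m n) (B C : Mat n o) → A ⊗ (B ⊖ C) ≋ A ⊗ B ⊖ A ⊗ C
  ⊗-⊖-distribˡ A B C i j = trans
    (sum-cong λ k → trans (distribˡ (A i k) (B k j) (- C k j)) (+-congˡ (sym (-‿distribʳ-* (A i k) (C k j)))))
    (sum-minus (λ k → A i k * B k j) λ k → A i k * C k j)

  ⊗-⊖-distribʳ : ∀ {m n o} (A B : Mat m n) (C : Mat n o) → (A ⊖ B) ⊗ C ≋ A ⊗ C ⊖ B ⊗ C
  ⊗-⊖-distribʳ A B C i j = trans
    (sum-cong λ k → trans (distribʳ (C k j) (A i k) (- B i k)) (+-congˡ (sym (-‿distribˡ-* (B i k) (C k j)))))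
    (sum-minus (λ k → A i k * C k j) λ k → B i k * C k j)

  I-diag : ∀ {m} (i : Fin m) → I i i ≈ 1#
  I-diag i = reflexive (if-yes (i ≟ i) ≡.refl)

  I-off : ∀ {m} {i j : Fin m} → i ≢ j → I i j ≈ 0#
  I-off {i = i} {j} i≢j = reflexive (if-no (i ≟ j) i≢j)

  ⊗-identityˡ : ∀ {m n} (A : Mat m n) → I ⊗ A ≋ A
  ⊗-identityˡ A i j = begin
    sum (λ k → I i k * A k j)   ≈⟨ sum-single _ i (λ k k≢i → trans (*-congʳ (I-off (k≢i ∘ ≡.sym))) (zeroˡ _)) ⟩
    I i i * A i j               ≈⟨ *-congʳ (I-diag i) ⟩
    1# * A i j                  ≈⟨ *-identityˡ _ ⟩
    A i j                       ∎

  ⊗-identityʳ : ∀ {m n} (A : Mat m n) → A ⊗ I ≋ A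
  ⊗-identityʳ A i j = begin
    sum (λ k → A i k * I k j)   ≈⟨ sum-single _ j (λ k k≢j → trans (*-congˡ (I-off k≢j)) (zeroʳ _)) ⟩
    A i j * I j j               ≈⟨ *-congˡ (I-diag j) ⟩
    A i j * 1#                  ≈⟨ *-identityʳ _ ⟩
    A i j                       ∎

  tr-comm : ∀ {m n} (A : Mat m n) (B : Mat n m) → tr (A ⊗ B) ≈ tr (B ⊗ A)
  tr-comm A B = begin
    sum (λ i → sum (λ k → A i k * B k i))   ≈⟨ ∑-comm (λ i k → A i k * B k i) ⟩
    sum (λ k → sum (λ i → A i k * B k i))   ≈⟨ sum-cong (λ k → sum-cong λ i → *-comm (A i k) (B k i)) ⟩
    sum (λ k → sum (λ i → B k i * A i k))   ∎

-- Integer matrices intertwined over the ring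

module Intertwining {c ℓ} (R : CommutativeRing c ℓ) where
  open CommutativeRing R hiding (zero)
  open IntegerImage R
  open Matrices R
  private module ℤᴹ = Matrices ℤ.+-*-commutativeRing
  open import Relation.Binary.Reasoning.Setoid setoid

  ι-sum : ∀ {m} (f : Fin m → ℤ) → ι (ℤᴹ.sum f) ≈ sum (ι ∘ f)
  ι-sum {zero}  f = refl
  ι-sum {suc m} f = trans (ι-+ (f zero) (ℤᴹ.sum (f ∘ suc))) (+-congˡ (ι-sum (f ∘ suc)))

  ιᴹ : ∀ {m n} → ℤᴹ.Mat m n → Mat m n
  ιᴹ X i j = ι (X i j)

  ιᴹ-⊗ : ∀ {m n o} (X : ℤᴹ.Mat m n) (Y : ℤᴹ.Mat n o) → ιᴹ (X ℤᴹ.⊗ Y) ≋ ιᴹ X ⊗ ιᴹ Y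
  ιᴹ-⊗ X Y i j = trans (ι-sum λ k → X i k ℤ.* Y k j) (sum-cong λ k → ι-* (X i k) (Y k j))

  ιᴹ-⊖ : ∀ {m n} (X Y : ℤᴹ.Mat m n) → ιᴹ (X ℤᴹ.⊖ Y) ≋ ιᴹ X ⊖ ιᴹ Y
  ιᴹ-⊖ X Y i j = ι-minus (X i j) (Y i j)

  ιᴹ-I : ∀ {m} → ιᴹ (ℤᴹ.I {m}) ≋ I
  ιᴹ-I i j with i ≟ j
  ... | yes _ = ι-1
  ... | no _  = refl

  module _ {m n} (T : Mat m n) where
    infix 4 _∼_

    -- Products, differences and the identity respect this relation, so it passes from the adjacency
    -- matrices to every polynomial in them. The related matrices stay integral, and only `T` has
    -- entries in the ring.
    _∼_ : ℤᴹ.Mat m m → ℤᴹ.Mat n n → Set ℓ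
    X ∼ Y = ιᴹ X ⊗ T ≋ T ⊗ ιᴹ Y

    ∼-⊗ : ∀ {X X′ Y Y′} → X ∼ Y → X′ ∼ Y′ → X ℤᴹ.⊗ X′ ∼ Y ℤᴹ.⊗ Y′
    ∼-⊗ {X} {X′} {Y} {Y′} e f i j = begin
      (ιᴹ (X ℤᴹ.⊗ X′) ⊗ T) i j      ≈⟨ ⊗-congʳ T (ιᴹ-⊗ X X′) i j ⟩
      ((ιᴹ X ⊗ ιᴹ X′) ⊗ T) i j      ≈⟨ ⊗-assoc (ιᴹ X) (ιᴹ X′) T i j ⟩
      (ιᴹ X ⊗ (ιᴹ X′ ⊗ T)) i j      ≈⟨ ⊗-congˡ (ιᴹ X) f i j ⟩
      (ιᴹ X ⊗ (T ⊗ ιᴹ Y′)) i j      ≈⟨ ⊗-assoc (ιᴹ X) T (ιᴹ Y′) i j ⟨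
      ((ιᴹ X ⊗ T) ⊗ ιᴹ Y′) i j      ≈⟨ ⊗-congʳ (ιᴹ Y′) e i j ⟩
      ((T ⊗ ιᴹ Y) ⊗ ιᴹ Y′) i j      ≈⟨ ⊗-assoc T (ιᴹ Y) (ιᴹ Y′) i j ⟩
      (T ⊗ (ιᴹ Y ⊗ ιᴹ Y′)) i j      ≈⟨ ⊗-congˡ T (ιᴹ-⊗ Y Y′) i j ⟨
      (T ⊗ ιᴹ (Y ℤᴹ.⊗ Y′)) i j      ∎

    ∼-⊖ : ∀ {X X′ Y Y′} → X ∼ Y → X′ ∼ Y′ → X ℤᴹ.⊖ X′ ∼ Y ℤᴹ.⊖ Y′
    ∼-⊖ {X} {X′} {Y} {Y′} e f i j = begin
      (ιᴹ (X ℤᴹ.⊖ X′) ⊗ T) i j               ≈⟨ ⊗-congʳ T (ιᴹ-⊖ X X′) i j ⟩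
      ((ιᴹ X ⊖ ιᴹ X′) ⊗ T) i j               ≈⟨ ⊗-⊖-distribʳ (ιᴹ X) (ιᴹ X′) T i j ⟩
      (ιᴹ X ⊗ T ⊖ ιᴹ X′ ⊗ T) i j             ≈⟨ +-cong (e i j) (-‿cong (f i j)) ⟩
      (T ⊗ ιᴹ Y ⊖ T ⊗ ιᴹ Y′) i j             ≈⟨ ⊗-⊖-distribˡ T (ιᴹ Y) (ιᴹ Y′) i j ⟨
      (T ⊗ (ιᴹ Y ⊖ ιᴹ Y′)) i j               ≈⟨ ⊗-congˡ T (ιᴹ-⊖ Y Y′) i j ⟨
      (T ⊗ ιᴹ (Y ℤᴹ.⊖ Y′)) i j               ∎

    ∼-I : ℤᴹ.I ∼ ℤᴹ.I
    ∼-I i j = begin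
      (ιᴹ ℤᴹ.I ⊗ T) i j   ≈⟨ ⊗-congʳ T ιᴹ-I i j ⟩
      (I ⊗ T) i j         ≈⟨ ⊗-identityˡ T i j ⟩
      T i j               ≈⟨ ⊗-identityʳ T i j ⟨
      (T ⊗ I) i j         ≈⟨ ⊗-congˡ T ιᴹ-I i j ⟨
      (T ⊗ ιᴹ ℤᴹ.I) i j   ∎

    module _ (S : Mat n m) (TS : T ⊗ S ≋ I) where
      ∼⇒conjugate : ∀ {X Y} → X ∼ Y → ιᴹ X ≋ T ⊗ (ιᴹ Y ⊗ S)
      ∼⇒conjugate {X} {Y} e i j = begin
        ιᴹ X i j                  ≈⟨ ⊗-identityʳ (ιᴹ X) i j ⟨
        (ιᴹ X ⊗ I) i j            ≈⟨ ⊗-congˡ (ιᴹ X) TS i j ⟨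
        (ιᴹ X ⊗ (T ⊗ S)) i j      ≈⟨ ⊗-assoc (ιᴹ X) T S i j ⟨
        ((ιᴹ X ⊗ T) ⊗ S) i j      ≈⟨ ⊗-congʳ S e i j ⟩
        ((T ⊗ ιᴹ Y) ⊗ S) i j      ≈⟨ ⊗-assoc T (ιᴹ Y) S i j ⟩
        (T ⊗ (ιᴹ Y ⊗ S)) i j      ∎

      ∼⇒tr : S ⊗ T ≋ I → ∀ {X Y} → X ∼ Y → ι (ℤᴹ.tr X) ≈ ι (ℤᴹ.tr Y)
      ∼⇒tr ST {X} {Y} e = begin
        ι (ℤᴹ.tr X)               ≈⟨ ι-sum (λ i → X i i) ⟩
        tr (ιᴹ X)                 ≈⟨ sum-cong (λ i → ∼⇒conjugate {X} {Y} e i i) ⟩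
        tr (T ⊗ (ιᴹ Y ⊗ S))       ≈⟨ tr-comm T (ιᴹ Y ⊗ S) ⟩
        tr ((ιᴹ Y ⊗ S) ⊗ T)       ≈⟨ sum-cong (λ i → ⊗-assoc (ιᴹ Y) S T i i) ⟩
        tr (ιᴹ Y ⊗ (S ⊗ T))       ≈⟨ sum-cong (λ i → ⊗-congˡ (ιᴹ Y) ST i i) ⟩
        tr (ιᴹ Y ⊗ I)             ≈⟨ sum-cong (λ i → ⊗-identityʳ (ιᴹ Y) i i) ⟩
        tr (ιᴹ Y)                 ≈⟨ ι-sum (λ i → Y i i) ⟨
        ι (ℤᴹ.tr Y)               ∎

-- Integer matrices of a graph, and their values for the friendship graph

module ℤᴹ = Matrices ℤ.+-*-commutativeRing
open ℤᴹ using () renaming (_⊗_ to _⊗ᶻ_; _⊖_ to _⊖ᶻ_; _≋_ to _≋ᶻ_)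

module _ where
  open import Data.Integer.Base using (_+_; _*_; _-_)
  open ℤᴹ using (Mat; sum; sum-cong; sum-single; tr; I; I-diag; I-off)
  open import Relation.Binary.PropositionalEquality using (refl; sym; trans; cong; cong₂)


  module Adjacency (G : Graph) where
    open Graph G

    a s b p : Mat order order
    a u v = if ⌊ u ~? v ⌋ then + 1 else + 0
    s = a ⊗ᶻ a
    b = s ⊖ᶻ I
    p = a ⊗ᶻ b

    a-yes : ∀ {u v} → u ~ v → a u v ≡ + 1
    a-yes {u} {v} = if-yes (u ~? v)

    a-no : ∀ {u v} → ¬ u ~ v → a u v ≡ + 0
    a-no {u} {v} = if-no (u ~? v)

    a-sym : ∀ u v → a u v ≡ a v u
    a-sym u v with u ~? v
    ... | yes e = sym (a-yes (~-sym e))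
    ... | no ¬e = sym (a-no (¬e ∘ ~-sym))

  sum-const : ∀ m (c : ℤ) → sum {m} (λ _ → c) ≡ + m * c
  sum-const zero    c = sym (ℤ.*-zeroˡ c)
  sum-const (suc m) c = trans (cong (λ t → c + t) (sum-const m c)) (sym (ℤ.suc-* (+ m) c))

  -- Matrices that are constant on the blocks of the partition into centre and leaves. For `F n`
  -- both `b` and `p` have this shape, although `a` has not.
  block : ∀ {m} → ℤ → ℤ → ℤ → ℤ → Mat (suc m) (suc m)
  block x y z w zero    zero    = x
  block x y z w zero    (suc _) = y
  block x y z w (suc _) zero    = z
  block x y z w (suc _) (suc _) = w

  block-cong : ∀ {m x y z w x′ y′ z′ w′} → x ≡ x′ → y ≡ y′ → z ≡ z′ → w ≡ w′ →
               block {m} x y z w ≋ᶻ block x′ y′ z′ w′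
  block-cong refl refl refl refl _ _ = refl

  block-⊗ : ∀ {m} x y z w x′ y′ z′ w′ → block {m} x y z w ⊗ᶻ block x′ y′ z′ w′ ≋ᶻ
    block (x * x′ + + m * (y * z′)) (x * y′ + + m * (y * w′))
          (z * x′ + + m * (w * z′)) (z * y′ + + m * (w * w′))
  block-⊗ {m} x y z w x′ y′ z′ w′ = λ where
    zero    zero    → cong (λ t → x * x′ + t) (sum-const m (y * z′))
    zero    (suc _) → cong (λ t → x * y′ + t) (sum-const m (y * w′))
    (suc _) zero    → cong (λ t → z * x′ + t) (sum-const m (w * z′))
    (suc _) (suc _) → cong (λ t → z * y′ + t) (sum-const m (w * w′))

  -- The other leaf of the same triangle; the recursion follows the numbering by `quotient 2`.
  twin : ∀ {n} → Fin (n ℕ.* 2) → Fin (n ℕ.* 2)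
  twin {suc n} zero          = suc zero
  twin {suc n} (suc zero)    = zero
  twin {suc n} (suc (suc i)) = suc (suc (twin {n} i))

  twin-involutive : ∀ {n} i → twin {n} (twin {n} i) ≡ i
  twin-involutive {suc n} zero          = refl
  twin-involutive {suc n} (suc zero)    = refl
  twin-involutive {suc n} (suc (suc i)) = cong (λ k → Fin.suc (Fin.suc k)) (twin-involutive {n} i)

  twin-≢ : ∀ {n} i → i ≢ twin {n} i
  twin-≢ {suc n} zero          ()
  twin-≢ {suc n} (suc zero)    ()
  twin-≢ {suc n} (suc (suc i)) e = twin-≢ {n} i (suc-injective (suc-injective e))

  quotient-twin : ∀ {n} i → quotient {n} 2 i ≡ quotient {n} 2 (twin {n} i)
  quotient-twin {suc n} zero          = refl
  quotient-twin {suc n} (suc zero)    = refl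
  quotient-twin {suc n} (suc (suc i)) = cong suc (quotient-twin {n} i)

  quotient-injective : ∀ {n} i j → i ≢ j → quotient {n} 2 i ≡ quotient {n} 2 j → j ≡ twin {n} i
  quotient-injective {suc n} zero zero i≢j _ = contradiction refl i≢j
  quotient-injective {suc n} zero (suc zero) _ _ = refl
  quotient-injective {suc n} (suc zero) zero _ _ = refl
  quotient-injective {suc n} (suc zero) (suc zero) i≢j _ = contradiction refl i≢j
  quotient-injective {suc n} (suc (suc i)) (suc (suc j)) i≢j e =
    cong (λ k → Fin.suc (Fin.suc k)) (quotient-injective {n} i j (λ e → i≢j (cong (λ k → Fin.suc (Fin.suc k)) e)) (suc-injective e))

  module Friendship (n : ℕ) where
    open Adjacency (F n)

    m : ℤ
    m = + (n ℕ.* 2)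

    a-twin : ∀ i → a (suc i) (suc (twin {n} i)) ≡ + 1
    a-twin i = a-yes (twin-≢ {n} i , quotient-twin {n} i)

    a-not-twin : ∀ i j → j ≢ twin {n} i → a (suc i) (suc j) ≡ + 0
    a-not-twin i j j≢ = a-no {suc i} {suc j} λ (i≢j , e) → j≢ (quotient-injective {n} i j i≢j e)

    leaf-sum : ∀ i (x : Fin (suc (n ℕ.* 2)) → ℤ) →
               sum (λ k → a (suc i) k * x k) ≡ x zero + x (suc (twin {n} i))
    leaf-sum i x = cong₂ _+_ (ℤ.*-identityˡ (x zero))
      (trans (sum-single _ (twin {n} i) λ k k≢ → trans (cong (λ t → t * x (suc k)) (a-not-twin i k k≢)) (ℤ.*-zeroˡ (x (suc k))))
             (trans (cong (λ t → t * x (suc (twin {n} i))) (a-twin i)) (ℤ.*-identityˡ _)))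

    center-sum : ∀ (x : Fin (suc (n ℕ.* 2)) → ℤ) →
                 sum (λ k → a zero k * x k) ≡ sum (x ∘ suc)
    center-sum x = trans (ℤ.+-identityˡ _) (sum-cong λ k → ℤ.*-identityˡ (x (suc k)))

    a-⊗-block : ∀ x y z w → a ⊗ᶻ block x y z w ≋ᶻ block (m * z) (m * w) (x + z) (y + w)
    a-⊗-block x y z w zero    zero    = trans (center-sum λ k → block x y z w k zero) (sum-const (n ℕ.* 2) z)
    a-⊗-block x y z w zero    (suc j) = trans (center-sum λ k → block x y z w k (suc j)) (sum-const (n ℕ.* 2) w)
    a-⊗-block x y z w (suc i) zero    = leaf-sum i λ k → block x y z w k zero
    a-⊗-block x y z w (suc i) (suc j) = leaf-sum i λ k → block x y z w k (suc j)

    B P : Mat (suc (n ℕ.* 2)) (suc (n ℕ.* 2))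
    B = block (m - + 1) (+ 1) (+ 1) (+ 1)
    P = block m m m (+ 2)

    -- The centre and a leaf share exactly the twin of the leaf. Any two leaves share the centre;
    -- the extra path from a leaf to itself through its twin lies on the diagonal, where subtracting
    -- `I` removes it.
    b≋B : b ≋ᶻ B
    b≋B zero zero = cong (λ t → t - + 1)
      (trans (center-sum λ k → a k zero) (trans (sum-const (n ℕ.* 2) (+ 1)) (ℤ.*-identityʳ m)))
    b≋B zero (suc j) = cong (λ t → t - + 0)
      (trans (center-sum λ k → a k (suc j))
        (trans (sum-cong λ k → a-sym (suc k) (suc j))
          (trans (sum-single _ (twin {n} j) (a-not-twin j)) (a-twin j))))
    b≋B (suc i) zero = cong (λ t → t - + 0) (leaf-sum i λ k → a k zero)
    b≋B (suc i) (suc j) = trans (cong (λ t → t - I (suc i) (suc j)) (leaf-sum i λ k → a k (suc j))) (eq (i ≟ j))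
      where
      eq : Dec (i ≡ j) → + 1 + a (suc (twin {n} i)) (suc j) - I (suc i) (suc j) ≡ + 1
      eq (yes refl) = cong₂ (λ s t → + 1 + s - t)
        (trans (a-sym (suc (twin {n} i)) (suc i)) (a-twin i)) (I-diag (suc i))
      eq (no i≢j) = cong₂ (λ s t → + 1 + s - t)
        (a-not-twin (twin {n} i) j λ e → i≢j (sym (trans e (twin-involutive {n} i))))
        (I-off (i≢j ∘ suc-injective))

    p≋P : p ≋ᶻ P
    p≋P = ℤᴹ.≋-trans (ℤᴹ.⊗-congˡ a b≋B) (ℤᴹ.≋-trans (a-⊗-block _ _ _ _)
      (block-cong (ℤ.*-identityʳ m) (ℤ.*-identityʳ m) (lem m) refl))
      where
      lem : ∀ m → m - + 1 + + 1 ≡ m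
      lem = ℤRing.solve-∀

    -- The factor A² - I kills the eigenvectors for 1 and -1, and the other two eigenvalues of `F n`
    -- are the roots of x² = x + 2n.
    s⊗b : ∀ u v → (s ⊗ᶻ b) u v ≡ p u v + m * b u v
    s⊗b u v = trans (ℤᴹ.⊗-assoc a a b u v) (trans (ℤᴹ.⊗-congˡ a p≋P u v)
      (trans (a-⊗-block m m m (+ 2) u v)
        (trans (eq u v) (sym (cong₂ _+_ (p≋P u v) (cong (m *_) (b≋B u v)))))))
      where
      e₁ : ∀ m → m * m ≡ m + m * (m - + 1)
      e₁ = ℤRing.solve-∀
      e₂ : ∀ m → m * + 2 ≡ m + m * + 1
      e₂ = ℤRing.solve-∀
      e₃ : ∀ m → m + m ≡ m + m * + 1
      e₃ = ℤRing.solve-∀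
      e₄ : ∀ m → m + + 2 ≡ + 2 + m * + 1
      e₄ = ℤRing.solve-∀
      eq : ∀ u v → block (m * m) (m * + 2) (m + m) (m + + 2) u v ≡ P u v + m * B u v
      eq zero    zero    = e₁ m
      eq zero    (suc _) = e₂ m
      eq (suc _) zero    = e₃ m
      eq (suc _) (suc _) = e₄ m

    tr-b : tr b ≡ (m - + 1) + m
    tr-b = trans (sum-cong λ i → b≋B i i) (cong (λ t → (m - + 1) + t) (trans (sum-const (n ℕ.* 2) (+ 1)) (ℤ.*-identityʳ m)))

    tr-b² : tr (b ⊗ᶻ b) ≡ + 2 * m * m + + 1
    tr-b² = trans (sum-cong λ i → trans (ℤᴹ.⊗-cong b≋B b≋B i i) (block-⊗ (m - + 1) (+ 1) (+ 1) (+ 1) (m - + 1) (+ 1) (+ 1) (+ 1) i i))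
      (trans (cong (λ t → ((m - + 1) * (m - + 1) + m * + 1) + t) (sum-const (n ℕ.* 2) _)) (lem m))
      where
      lem : ∀ m → ((m - + 1) * (m - + 1) + m * + 1) + m * (+ 1 + m * + 1) ≡ + 2 * m * m + + 1
      lem = ℤRing.solve-∀

  -- All that the combinatorial argument uses of the spectrum, as integer identities about `G`. The
  -- field `rank₂` is the vanishing of the 3 by 3 minor of `b` with rows u, v, z and columns u, v,
  -- w. The field `trace₁` says that A has trace 1 on the plane, multiplied by the Gram determinant
  -- of u and v.
  record SpectralFacts (n : ℕ) (G : Graph) : Set where
    open Adjacency G
    field
      order≡ : Graph.order G ≡ suc (n ℕ.* 2)
      tr-b   : tr b ≡ (+ (n ℕ.* 2) - + 1) + + (n ℕ.* 2)
      tr-b²  : tr (b ⊗ᶻ b) ≡ + 2 * + (n ℕ.* 2) * + (n ℕ.* 2) + + 1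
      s⊗b    : ∀ u v → (s ⊗ᶻ b) u v ≡ p u v + + (n ℕ.* 2) * b u v
      rank₂  : ∀ u v z w → (b u u * b v v - b u v * b v u) * b z w ≡
               b z u * (b v v * b u w - b u v * b v w) +
               b z v * (b u u * b v w - b v u * b u w)
      trace₁ : ∀ u v → (b v v * p u u + b u u * p v v) - (b u v * p v u + b v u * p u v) ≡
               b u u * b v v - b u v * b v u

-- From equal spectra to similar adjacency matrices

module _ {c ℓ₁ ℓ₂} (K : HeytingField c ℓ₁ ℓ₂) where
  underlyingRing : CommutativeRing c ℓ₁
  underlyingRing = HeytingCommutativeRing.commutativeRing (HeytingField.heytingCommutativeRing K)

  open CommutativeRing underlyingRing hiding (zero)
  open IntegerImage underlyingRing
  open Matrices underlyingRing
  open Intertwining underlyingRing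
  open import Algebra.Properties.Semiring.Sum semiring using (sum-permute)
  open import Relation.Binary.Reasoning.Setoid setoid

  ιᴹ-adjacency : ∀ G → ιᴹ (Adjacency.a G) ≋ adjacencyMatrix K G
  ιᴹ-adjacency G u v with Graph._~?_ G u v
  ... | yes _ = ι-1
  ... | no _  = refl

  record Similarity (G H : Graph) : Set (c ⊔ ℓ₁) where
    field
      T     : Mat (Graph.order G) (Graph.order H)
      S     : Mat (Graph.order H) (Graph.order G)
      TS    : T ⊗ S ≋ I
      ST    : S ⊗ T ≋ I
      inter : _∼_ T (Adjacency.a G) (Adjacency.a H)

  -- With D the diagonal matrix of `e`, the reason is Q A = Q A P Q = Q P D Q = D Q.
  left-eigen : ∀ {m} (A : Mat m m) (e : Fin m → Carrier) (P Q : Mat m m) →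
               P ⊗ Q ≋ I → Q ⊗ P ≋ I → (∀ i j → (A ⊗ P) i j ≈ e j * P i j) →
               ∀ i j → (Q ⊗ A) i j ≈ e i * Q i j
  left-eigen A e P Q PQ QP AP i j = begin
    (Q ⊗ A) i j                          ≈⟨ ⊗-identityʳ (Q ⊗ A) i j ⟨
    ((Q ⊗ A) ⊗ I) i j                    ≈⟨ ⊗-congˡ (Q ⊗ A) PQ i j ⟨
    ((Q ⊗ A) ⊗ (P ⊗ Q)) i j              ≈⟨ ⊗-assoc (Q ⊗ A) P Q i j ⟨
    (((Q ⊗ A) ⊗ P) ⊗ Q) i j              ≈⟨ ⊗-congʳ Q (⊗-assoc Q A P) i j ⟩
    ((Q ⊗ (A ⊗ P)) ⊗ Q) i j              ≈⟨ ⊗-congʳ Q QAP i j ⟩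
    sum (λ k → e k * I i k * Q k j)      ≈⟨ sum-single _ i (λ k k≢i →
                                              trans (*-congʳ (trans (*-congˡ (I-off (k≢i ∘ ≡.sym))) (zeroʳ _))) (zeroˡ _)) ⟩
    e i * I i i * Q i j                  ≈⟨ *-congʳ (trans (*-congˡ (I-diag i)) (*-identityʳ _)) ⟩
    e i * Q i j                          ∎
    where
    QAP : Q ⊗ (A ⊗ P) ≋ λ i j → e j * I i j
    QAP i j = begin
      sum (λ k → Q i k * (A ⊗ P) k j)   ≈⟨ sum-cong (λ k → *-congˡ (AP k j)) ⟩
      sum (λ k → Q i k * (e j * P k j)) ≈⟨ sum-cong (λ k → solve 3 (λ x y z → x :* (y :* z) := y :* (x :* z)) refl (Q i k) (e j) (P k j)) ⟩
      sum (λ k → e j * (Q i k * P k j)) ≈⟨ *-distribˡ-sum (e j) (λ k → Q i k * P k j) ⟨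
      e j * (Q ⊗ P) i j                 ≈⟨ *-congˡ (QP i j) ⟩
      e j * I i j                       ∎

  I-permute : ∀ {m n} (π : Permutation m n) i j → I (π ⟨$⟩ʳ i) (π ⟨$⟩ʳ j) ≈ I i j
  I-permute π i j with i ≟ j
  ... | yes ≡.refl = I-diag (π ⟨$⟩ʳ i)
  ... | no i≢j     = I-off λ e → i≢j (≡.trans (≡.sym (Perm.inverseˡ π)) (≡.trans (≡.cong (π ⟨$⟩ˡ_) e) (Perm.inverseˡ π)))

  open ListPermutation setoid using (_↭_; onIndices)

  module _ {m n} {d : Fin m → Carrier} {e : Fin n → Carrier}
           (d↭e : List.tabulate d ↭ List.tabulate e) where

    ↭⇒permutation : Permutation m n
    ↭⇒permutation = cast-id (≡.sym (length-tabulate d)) ∘ₚ (onIndices d↭e ∘ₚ cast-id (length-tabulate e))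

    ↭⇒≈ : ∀ i → d i ≈ e (↭⇒permutation ⟨$⟩ʳ i)
    ↭⇒≈ i = begin
      d i                                 ≡⟨ lookup-tabulate d i ⟨
      List.lookup (List.tabulate d) j     ≈⟨ Permutationₚ.onIndices-lookup setoid d↭e j ⟩
      List.lookup (List.tabulate e) k     ≡⟨ ≡.cong (List.lookup (List.tabulate e)) cast-cast ⟨
      List.lookup (List.tabulate e) k′    ≡⟨ lookup-tabulate e (↭⇒permutation ⟨$⟩ʳ i) ⟩
      e (↭⇒permutation ⟨$⟩ʳ i)            ∎
      where
      j  = cast (≡.sym (length-tabulate d)) i
      k  = onIndices d↭e ⟨$⟩ʳ j
      k′ = cast (≡.sym (length-tabulate e)) (cast (length-tabulate e) k)

      cast-cast : k′ ≡ k
      cast-cast = cast-involutive (≡.sym (length-tabulate e)) (length-tabulate e) k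

  -- After the eigenvectors of `H` are reordered by `π`, both adjacency matrices are diagonalised to
  -- the same D. Composing one eigenbasis with the inverse of the other then intertwines them.
  cospectral⇒similar : ∀ {G H} → Cospectral K G H → Similarity G H
  cospectral⇒similar {G} {H} (d , e , (P , Q , PQ , QP , AP) , (P′ , Q′ , PQ′ , QP′ , AP′) , d↭e) = record
    { T = T ; S = S ; TS = TS ; ST = ST ; inter = inter }
    where
    π = ↭⇒permutation d↭e
    Pπ : Mat (Graph.order H) (Graph.order G)
    Pπ k i = P′ k (π ⟨$⟩ʳ i)
    Qπ : Mat (Graph.order G) (Graph.order H)
    Qπ i k = Q′ (π ⟨$⟩ʳ i) k
    T = P ⊗ Qπ
    S = Pπ ⊗ Q

    QPπ : Qπ ⊗ Pπ ≋ I
    QPπ i j = trans (QP′ _ _) (I-permute π i j)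

    PQπ : Pπ ⊗ Qπ ≋ I
    PQπ i j = trans (sym (sum-permute (λ k → P′ i k * Q′ k j) π)) (PQ′ i j)

    cancel : ∀ {m n o} (A : Mat m n) (B : Mat n o) (C : Mat o n) (D : Mat n m) →
             B ⊗ C ≋ I → A ⊗ D ≋ I → (A ⊗ B) ⊗ (C ⊗ D) ≋ I
    cancel A B C D BC AD i j = begin
      ((A ⊗ B) ⊗ (C ⊗ D)) i j  ≈⟨ ⊗-assoc A B (C ⊗ D) i j ⟩
      (A ⊗ (B ⊗ (C ⊗ D))) i j  ≈⟨ ⊗-congˡ A (⊗-assoc B C D) i j ⟨
      (A ⊗ ((B ⊗ C) ⊗ D)) i j  ≈⟨ ⊗-congˡ A (⊗-congʳ D BC) i j ⟩
      (A ⊗ (I ⊗ D)) i j        ≈⟨ ⊗-congˡ A (⊗-identityˡ D) i j ⟩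
      (A ⊗ D) i j              ≈⟨ AD i j ⟩
      I i j                    ∎

    TS : T ⊗ S ≋ I
    TS = cancel P Qπ Pπ Q QPπ PQ

    ST : S ⊗ T ≋ I
    ST = cancel Pπ Q P Qπ QP PQπ

    inter : _∼_ T (Adjacency.a G) (Adjacency.a H)
    inter u k = begin
      (ιᴹ (Adjacency.a G) ⊗ (P ⊗ Qπ)) u k        ≈⟨ ⊗-congʳ T (ιᴹ-adjacency G) u k ⟩
      (A ⊗ (P ⊗ Qπ)) u k                         ≈⟨ ⊗-assoc A P Qπ u k ⟨
      ((A ⊗ P) ⊗ Qπ) u k                         ≈⟨ sum-cong (λ i → *-congʳ (AP u i)) ⟩
      sum (λ i → d i * P u i * Qπ i k)           ≈⟨ sum-cong (λ i → *-congʳ (*-congʳ (↭⇒≈ d↭e i))) ⟩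
      sum (λ i → eπ i * P u i * Qπ i k)          ≈⟨ sum-cong (λ i → solve 3 (λ x y z → x :* y :* z := y :* (x :* z)) refl (eπ i) (P u i) (Qπ i k)) ⟩
      sum (λ i → P u i * (eπ i * Qπ i k))        ≈⟨ sum-cong (λ i → *-congˡ (left-eigen B e P′ Q′ PQ′ QP′ AP′ (π ⟨$⟩ʳ i) k)) ⟨
      (P ⊗ (Qπ ⊗ B)) u k                         ≈⟨ ⊗-assoc P Qπ B u k ⟨
      ((P ⊗ Qπ) ⊗ B) u k                         ≈⟨ ⊗-congˡ T (ιᴹ-adjacency H) u k ⟨
      ((P ⊗ Qπ) ⊗ ιᴹ (Adjacency.a H)) u k        ∎
      where
      A = adjacencyMatrix K G
      B = adjacencyMatrix K H
      eπ : Fin (Graph.order G) → Carrier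
      eπ i = e (π ⟨$⟩ʳ i)

-- Integer identities from the similarity, in characteristic zero

module _ {c ℓ₁ ℓ₂} (K : HeytingField c ℓ₁ ℓ₂) (char0 : CharacteristicZero K) where
  open CommutativeRing (underlyingRing K) hiding (zero)
  open IntegerImage (underlyingRing K)
  open Matrices (underlyingRing K)
  open Intertwining (underlyingRing K)
  open import Algebra.Properties.Ring ring using (-0#≈0#; -‿involutive; x≈y⇒x∙y⁻¹≈ε)
  open import Relation.Binary.Reasoning.Setoid setoid

  ι≈0⇒≡0 : ∀ i → ι i ≈ 0# → i ≡ + 0
  ι≈0⇒≡0 (+ zero)  _ = ≡.refl
  ι≈0⇒≡0 (+ suc k) e = contradiction (char0 k) (HeytingField.#-irrefl K e)
  ι≈0⇒≡0 -[1+ k ]  e = contradiction (char0 k) (HeytingField.#-irrefl K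
    (trans (sym (-‿involutive _)) (trans (-‿cong e) -0#≈0#)))

  -- This pulls identities verified in `K` back to the integers.
  ι-injective : ∀ i j → ι i ≈ ι j → i ≡ j
  ι-injective i j e = ℤ.i-j≡0⇒i≡j i j (ι≈0⇒≡0 (i ℤ.- j)
    (trans (ι-minus i j) (x≈y⇒x∙y⁻¹≈ε e)))

  -- A wrapper for ι i ≈ x from which i can be inferred.
  infix 4 _↦_
  record _↦_ (i : ℤ) (x : Carrier) : Set ℓ₁ where
    constructor image
    field ≈image : ι i ≈ x

  infixl 6 _⟨+⟩_ _⟨-⟩_
  infixl 7 _⟨*⟩_

  _⟨+⟩_ : ∀ {i j x y} → i ↦ x → j ↦ y → i ℤ.+ j ↦ x + y
  _⟨+⟩_ {i} {j} (image e) (image f) = image (trans (ι-+ i j) (+-cong e f))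

  _⟨-⟩_ : ∀ {i j x y} → i ↦ x → j ↦ y → i ℤ.- j ↦ x - y
  _⟨-⟩_ {i} {j} (image e) (image f) = image (trans (ι-minus i j) (+-cong e (-‿cong f)))

  _⟨*⟩_ : ∀ {i j x y} → i ↦ x → j ↦ y → i ℤ.* j ↦ x * y
  _⟨*⟩_ {i} {j} (image e) (image f) = image (trans (ι-* i j) (*-cong e f))

  images-agree : ∀ {i j x y} → i ↦ x → j ↦ y → x ≈ y → i ≡ j
  images-agree {i} {j} (image e) (image f) x≈y = ι-injective i j (trans e (trans x≈y (sym f)))

  -- A sum of two products of a column and a row has rank at most two, so its 3 by 3 minors vanish.
  rank₂-identity : ∀ αu γu βu φu αv γv βv φv αz γz βw φw →
    let b = λ α γ β φ → α * β + γ * φ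
        uu = b αu γu βu φu ; uv = b αu γu βv φv ; uw = b αu γu βw φw
        vu = b αv γv βu φu ; vv = b αv γv βv φv ; vw = b αv γv βw φw
        zu = b αz γz βu φu ; zv = b αz γz βv φv ; zw = b αz γz βw φw
    in (uu * vv - uv * vu) * zw ≈ zu * (vv * uw - uv * vw) + zv * (uu * vw - vu * uw)
  rank₂-identity = solve 12 (λ αu γu βu φu αv γv βv φv αz γz βw φw →
    let b = λ α γ β φ → α :* β :+ γ :* φ
        uu = b αu γu βu φu ; uv = b αu γu βv φv ; uw = b αu γu βw φw
        vu = b αv γv βu φu ; vv = b αv γv βv φv ; vw = b αv γv βw φw
        zu = b αz γz βu φu ; zv = b αz γz βv φv ; zw = b αz γz βw φw
    in (uu :* vv :- uv :* vu) :* zw := zu :* (vv :* uw :- uv :* vw) :+ zv :* (uu :* vw :- vu :* uw)) refl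

  -- Both sides are the determinant of the (γ , α), times that of the (φ , β), times a factor from
  -- the coefficient matrices (m - 1, 1; 1, 1) and (m, m; m, 2). On the left this factor is their
  -- mixed discriminant, on the right the determinant of the first; both equal m - 2.
  trace₁-identity : ∀ m αu γu βu φu αv γv βv φv →
    let b = λ α γ β φ → γ * ((m - ι (+ 1)) * φ + ι (+ 1) * β) + α * (ι (+ 1) * φ + ι (+ 1) * β)
        p = λ α γ β φ → γ * (m * φ + m * β) + α * (m * φ + ι (+ 2) * β)
        uu = b αu γu βu φu ; uv = b αu γu βv φv ; vu = b αv γv βu φu ; vv = b αv γv βv φv
        puu = p αu γu βu φu ; puv = p αu γu βv φv ; pvu = p αv γv βu φu ; pvv = p αv γv βv φv
    in (vv * puu + uu * pvv) - (uv * pvu + vu * puv) ≈ uu * vv - uv * vu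
  trace₁-identity = solve 9 (λ m αu γu βu φu αv γv βv φv →
    let b = λ α γ β φ → γ :* ((m :- con (+ 1)) :* φ :+ con (+ 1) :* β) :+ α :* (con (+ 1) :* φ :+ con (+ 1) :* β)
        p = λ α γ β φ → γ :* (m :* φ :+ m :* β) :+ α :* (m :* φ :+ con (+ 2) :* β)
        uu = b αu γu βu φu ; uv = b αu γu βv φv ; vu = b αv γv βu φu ; vv = b αv γv βv φv
        puu = p αu γu βu φu ; puv = p αu γu βv φv ; pvu = p αv γv βu φu ; pvv = p αv γv βv φv
    in (vv :* puu :+ uu :* pvv) :- (uv :* pvu :+ vu :* puv) := uu :* vv :- uv :* vu) refl

  -- A block matrix does not distinguish the leaves, so `T` and `S` enter only through their centre
  -- entries and their sums over the leaves. This is what bounds the rank by two.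
  conjugate-block : ∀ {m n} (T : Mat m (suc n)) (S : Mat (suc n) m) x y z w u v →
    (T ⊗ (ιᴹ (block x y z w) ⊗ S)) u v ≈
      T u zero * (ι x * S zero v + ι y * sum (λ k → S (suc k) v)) +
      sum (λ k → T u (suc k)) * (ι z * S zero v + ι w * sum (λ k → S (suc k) v))
  conjugate-block {m} {n} T S x y z w u v = begin
    T u zero * (ι x * S zero v + sum (λ k → ι y * S (suc k) v)) +
    sum (λ k → T u (suc k) * row)                                  ≈⟨ +-cong (*-congˡ (+-congˡ (sym (*-distribˡ-sum (ι y) Sv))))
                                                                             (sym (*-distribʳ-sum row λ k → T u (suc k))) ⟩
    T u zero * (ι x * S zero v + ι y * sum Sv) +
    sum (λ k → T u (suc k)) * row                                  ≈⟨ +-congˡ (*-congˡ (+-congˡ (sym (*-distribˡ-sum (ι w) Sv)))) ⟩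
    T u zero * (ι x * S zero v + ι y * sum Sv) +
    sum (λ k → T u (suc k)) * (ι z * S zero v + ι w * sum Sv)      ∎
    where
    Sv : Fin n → Carrier
    Sv k = S (suc k) v
    row : Carrier
    row = ι z * S zero v + sum (λ k → ι w * Sv k)

  ∼-scale : ∀ {m n} (T : Mat m n) x {X Y} → _∼_ T X Y →
            _∼_ T (λ i j → x ℤ.* X i j) (λ i j → x ℤ.* Y i j)
  ∼-scale T x {X} {Y} e i j = begin
    sum (λ k → ι (x ℤ.* X i k) * T k j)      ≈⟨ sum-cong (λ k → trans (*-congʳ (ι-* x (X i k))) (*-assoc (ι x) (ι (X i k)) (T k j))) ⟩
    sum (λ k → ι x * (ι (X i k) * T k j))    ≈⟨ *-distribˡ-sum (ι x) (λ k → ι (X i k) * T k j) ⟨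
    ι x * sum (λ k → ι (X i k) * T k j)      ≈⟨ *-congˡ (e i j) ⟩
    ι x * sum (λ k → T i k * ι (Y k j))      ≈⟨ *-distribˡ-sum (ι x) (λ k → T i k * ι (Y k j)) ⟩
    sum (λ k → ι x * (T i k * ι (Y k j)))    ≈⟨ sum-cong (λ k → trans
                                                  (solve 3 (λ x y z → x :* (y :* z) := y :* (x :* z)) refl (ι x) (T i k) (ι (Y k j)))
                                                  (*-congˡ (sym (ι-* x (Y k j))))) ⟩
    sum (λ k → T i k * ι (x ℤ.* Y k j))      ∎

  -- The order comes from the lengths of the two eigenvalue lists. Traces and `s⊗b` pass through the
  -- similarity from `F n`. The last two facts hold because `b` and `p` are conjugate to block
  -- matrices.
  spectralFacts : ∀ n G → Cospectral K G (F n) → SpectralFacts n G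
  spectralFacts n G cosp@(d , e , _ , _ , d↭e) = record
    { order≡ = ≡.trans (≡.sym (length-tabulate d)) (≡.trans (Permutationₚ.xs↭ys⇒|xs|≡|ys| setoid d↭e) (length-tabulate e))
    ; tr-b   = ≡.trans (tr≡ {b} {Fₙ.b} b∼) Fₙ.tr-b
    ; tr-b²  = ≡.trans (tr≡ {b ⊗ᶻ b} {Fₙ.b ⊗ᶻ Fₙ.b} (∼-⊗ T {b} {b} {Fₙ.b} {Fₙ.b} b∼ b∼)) Fₙ.tr-b²
    ; s⊗b    = s⊗b
    ; rank₂  = λ u v z w → images-agree
        ((B u u ⟨*⟩ B v v ⟨-⟩ B u v ⟨*⟩ B v u) ⟨*⟩ B z w)
        (B z u ⟨*⟩ (B v v ⟨*⟩ B u w ⟨-⟩ B u v ⟨*⟩ B v w) ⟨+⟩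
         B z v ⟨*⟩ (B u u ⟨*⟩ B v w ⟨-⟩ B v u ⟨*⟩ B u w))
        (rank₂-identity (α u) (γ u) (β′ u) (φ′ u) (α v) (γ v) (β′ v) (φ′ v) (α z) (γ z) (β′ w) (φ′ w))
    ; trace₁ = λ u v → images-agree
        ((B′ v v ⟨*⟩ P u u ⟨+⟩ B′ u u ⟨*⟩ P v v) ⟨-⟩ (B′ u v ⟨*⟩ P v u ⟨+⟩ B′ v u ⟨*⟩ P u v))
        (B′ u u ⟨*⟩ B′ v v ⟨-⟩ B′ u v ⟨*⟩ B′ v u)
        (trace₁-identity (ι m) (α u) (γ u) (β u) (φ u) (α v) (γ v) (β v) (φ v))
    }
    where
    open Similarity (cospectral⇒similar K {G} {F n} cosp)
    open Adjacency G using (a; s; b; p)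
    module Fₙ where
      open Adjacency (F n) public
      open Friendship n public

    m : ℤ
    m = + (n ℕ.* 2)

    s∼ : _∼_ T s Fₙ.s
    s∼ = ∼-⊗ T {a} {a} {Fₙ.a} {Fₙ.a} inter inter

    b∼ : _∼_ T b Fₙ.b
    b∼ = ∼-⊖ T {s} {ℤᴹ.I} {Fₙ.s} {ℤᴹ.I} s∼ (∼-I T)

    p∼ : _∼_ T p Fₙ.p
    p∼ = ∼-⊗ T {a} {b} {Fₙ.a} {Fₙ.b} inter b∼

    tr≡ : ∀ {X Y} → _∼_ T X Y → ℤᴹ.tr X ≡ ℤᴹ.tr Y
    tr≡ {X} {Y} e = ι-injective (ℤᴹ.tr X) (ℤᴹ.tr Y) (∼⇒tr T S TS ST {X} {Y} e)

    conjugate : ∀ {X Y Z} → _∼_ T X Y → Y ℤᴹ.≋ Z → ιᴹ X ≋ T ⊗ (ιᴹ Z ⊗ S)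
    conjugate {X} {Y} {Z} e f u v = trans (∼⇒conjugate T S TS {X} {Y} e u v)
      (⊗-congˡ T (⊗-congʳ S λ i j → ι-cong (f i j)) u v)

    s⊗b : ∀ u v → (s ⊗ᶻ b) u v ≡ p u v ℤ.+ m ℤ.* b u v
    -- The defect of the identity in `G` is intertwined with the defect in `F n`, which is zero, so
    -- it is a conjugate of the zero matrix.
    s⊗b u v = lemma (ι≈0⇒≡0 (((s ⊗ᶻ b) ⊖ᶻ p ⊖ᶻ mb) u v) (begin
      ι (((s ⊗ᶻ b) ⊖ᶻ p ⊖ᶻ mb) u v)   ≈⟨ conjugate {(s ⊗ᶻ b) ⊖ᶻ p ⊖ᶻ mb} {(Fₙ.s ⊗ᶻ Fₙ.b) ⊖ᶻ Fₙ.p ⊖ᶻ mbF} {λ _ _ → + 0} D∼ D≋0 u v ⟩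
      (T ⊗ (O ⊗ S)) u v               ≈⟨ sum-zero (λ k → trans (*-congˡ (sum-zero λ l → zeroˡ (S l v))) (zeroʳ (T u k))) ⟩
      0#                              ∎))
      where
      O : Mat (suc (n ℕ.* 2)) (suc (n ℕ.* 2))
      O _ _ = 0#
      mb : ℤᴹ.Mat (Graph.order G) (Graph.order G)
      mb i j = m ℤ.* b i j
      mbF : ℤᴹ.Mat (suc (n ℕ.* 2)) (suc (n ℕ.* 2))
      mbF i j = m ℤ.* Fₙ.b i j
      D∼ : _∼_ T ((s ⊗ᶻ b) ⊖ᶻ p ⊖ᶻ mb) ((Fₙ.s ⊗ᶻ Fₙ.b) ⊖ᶻ Fₙ.p ⊖ᶻ mbF)
      D∼ = ∼-⊖ T {(s ⊗ᶻ b) ⊖ᶻ p} {mb} {(Fₙ.s ⊗ᶻ Fₙ.b) ⊖ᶻ Fₙ.p} {mbF}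
        (∼-⊖ T {s ⊗ᶻ b} {p} {Fₙ.s ⊗ᶻ Fₙ.b} {Fₙ.p} (∼-⊗ T {s} {b} {Fₙ.s} {Fₙ.b} s∼ b∼) p∼)
        (∼-scale T m {b} {Fₙ.b} b∼)
      D≋0 : (Fₙ.s ⊗ᶻ Fₙ.b) ⊖ᶻ Fₙ.p ⊖ᶻ mbF ℤᴹ.≋ λ _ _ → + 0
      D≋0 i j = ≡.trans (≡.cong (λ t → t ℤ.- Fₙ.p i j ℤ.- mbF i j) (Fₙ.s⊗b i j)) (eq (Fₙ.p i j) (mbF i j))
        where
        eq : ∀ x y → x ℤ.+ y ℤ.- x ℤ.- y ≡ + 0
        eq = ℤRing.solve-∀
      lemma : ∀ {x y z} → x ℤ.- y ℤ.- z ≡ + 0 → x ≡ y ℤ.+ z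
      lemma {x} {y} {z} e = ℤ.i-j≡0⇒i≡j x (y ℤ.+ z) (≡.trans (eq x y z) e)
        where
        eq : ∀ x y z → x ℤ.- (y ℤ.+ z) ≡ x ℤ.- y ℤ.- z
        eq = ℤRing.solve-∀

    -- Leaf sums `α`, `β` and centre entries `γ`, `φ` of `T` and `S`. The primed functions absorb
    -- the coefficients of `Fₙ.B`, which displays `b` as a sum of two rank-one matrices.
    α γ β φ β′ φ′ : Fin (Graph.order G) → Carrier
    α u = sum λ k → T u (suc k)
    γ u = T u zero
    β v = sum λ k → S (suc k) v
    φ v = S zero v
    β′ v = φ v + β v
    φ′ v = (ι m - ι (+ 1)) * φ v + β v

    bᴷ : ∀ u v → ι (b u v) ≈ γ u * ((ι m - ι (+ 1)) * φ v + ι (+ 1) * β v) + α u * (ι (+ 1) * φ v + ι (+ 1) * β v)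
    bᴷ u v = begin
      ι (b u v)                       ≈⟨ conjugate {b} {Fₙ.b} {Fₙ.B} b∼ Fₙ.b≋B u v ⟩
      (T ⊗ (ιᴹ Fₙ.B ⊗ S)) u v         ≈⟨ conjugate-block T S (m ℤ.- + 1) (+ 1) (+ 1) (+ 1) u v ⟩
      _                               ≈⟨ +-congʳ (*-congˡ (+-congʳ (*-congʳ (ι-minus m (+ 1))))) ⟩
      _                               ∎

    bᴷ′ : ∀ u v → ι (b u v) ≈ α u * β′ v + γ u * φ′ v
    bᴷ′ u v = trans (bᴷ u v) (solve 5 (λ m α γ β φ →
      γ :* ((m :- con (+ 1)) :* φ :+ con (+ 1) :* β) :+ α :* (con (+ 1) :* φ :+ con (+ 1) :* β) :=
      α :* (φ :+ β) :+ γ :* ((m :- con (+ 1)) :* φ :+ β)) refl (ι m) (α u) (γ u) (β v) (φ v))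

    pᴷ : ∀ u v → ι (p u v) ≈ γ u * (ι m * φ v + ι m * β v) + α u * (ι m * φ v + ι (+ 2) * β v)
    pᴷ u v = trans (conjugate {p} {Fₙ.p} {Fₙ.P} p∼ Fₙ.p≋P u v) (conjugate-block T S m m m (+ 2) u v)

    B : ∀ u v → b u v ↦ α u * β′ v + γ u * φ′ v
    B u v = image (bᴷ′ u v)

    B′ : ∀ u v → b u v ↦ γ u * ((ι m - ι (+ 1)) * φ v + ι (+ 1) * β v) + α u * (ι (+ 1) * φ v + ι (+ 1) * β v)
    B′ u v = image (bᴷ u v)

    P : ∀ u v → p u v ↦ γ u * (ι m * φ v + ι m * β v) + α u * (ι m * φ v + ι (+ 2) * β v)
    P u v = image (pᴷ u v)

-- Integer inequalities and finite sums

open import Data.Integer.Base using (_+_; _*_; _-_; _≤_; +≤+; 0ℤ)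
open ℤᴹ using (Mat; sum; sum-cong; sum-single; sum-zero; sum-minus; sum-remove;
               *-distribˡ-sum; *-distribʳ-sum; tr; I; I-diag; I-off)
open import Relation.Binary.PropositionalEquality using (refl; sym; trans; cong; cong₂; subst; subst₂)

-- The slack `e` is given in a form that is visibly nonnegative; the remaining equation is left to
-- the ring solver.
0≤⇒≤ : ∀ {x y} e → 0ℤ ≤ e → y - x ≡ e → x ≤ y
0≤⇒≤ e 0≤e eq = ℤ.0≤i-j⇒j≤i (subst (0ℤ ≤_) (sym eq) 0≤e)

≤⇒0≤ : ∀ {x y} → x ≤ y → 0ℤ ≤ y - x
≤⇒0≤ = ℤ.i≤j⇒0≤j-i

*-nonneg : ∀ {x y} → 0ℤ ≤ x → 0ℤ ≤ y → 0ℤ ≤ x * y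
*-nonneg {+ m} {+ n} _ _ = subst (0ℤ ≤_) (ℤ.pos-* m n) (+≤+ z≤n)

+-nonneg : ∀ {x y} → 0ℤ ≤ x → 0ℤ ≤ y → 0ℤ ≤ x + y
+-nonneg = ℤ.+-mono-≤

square-nonneg : ∀ x → 0ℤ ≤ x * x
square-nonneg (+ m)    = *-nonneg {+ m} {+ m} (+≤+ z≤n) (+≤+ z≤n)
square-nonneg -[1+ m ] = +≤+ z≤n

nonneg-sum-zero : ∀ {x y} → 0ℤ ≤ x → 0ℤ ≤ y → x + y ≡ 0ℤ → x ≡ 0ℤ
nonneg-sum-zero {x} {y} 0≤x 0≤y e =
  ℤ.≤-antisym (0≤⇒≤ y 0≤y (trans (cong (_- x) (sym e)) (lemma x y))) 0≤x
  where
  lemma : ∀ x y → x + y - x ≡ y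
  lemma = ℤRing.solve-∀

≢0⇒1≤ : ∀ {x} → 0ℤ ≤ x → x ≢ 0ℤ → + 1 ≤ x
≢0⇒1≤ {+ zero}  _ x≢0 = contradiction refl x≢0
≢0⇒1≤ {+ suc _} _ _   = +≤+ (s≤s z≤n)

1≤⇒≢0 : ∀ {x} → + 1 ≤ x → x ≢ 0ℤ
1≤⇒≢0 (+≤+ (s≤s _)) ()

integral-domain : ∀ {x y} → x ≢ 0ℤ → x * y ≡ 0ℤ → y ≡ 0ℤ
integral-domain {x} x≢0 e with ℤ.i*j≡0⇒i≡0∨j≡0 x e
... | inj₁ x≡0 = contradiction x≡0 x≢0
... | inj₂ y≡0 = y≡0

sum-nonneg : ∀ {m} {f : Fin m → ℤ} → (∀ i → 0ℤ ≤ f i) → 0ℤ ≤ sum f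
sum-nonneg {zero}  _   = ℤ.≤-refl
sum-nonneg {suc m} 0≤f = +-nonneg (0≤f zero) (sum-nonneg (0≤f ∘ suc))

sum-mono : ∀ {m} {f g : Fin m → ℤ} → (∀ i → f i ≤ g i) → sum f ≤ sum g
sum-mono {zero}  h = ℤ.≤-refl
sum-mono {suc m} h = ℤ.+-mono-≤ (h zero) (sum-mono (h ∘ suc))

module _ {m : ℕ} (f : Fin (suc m) → ℤ) (0≤f : ∀ i → 0ℤ ≤ f i) where
  term≤sum : ∀ i → f i ≤ sum f
  term≤sum i = subst (f i ≤_) (sym (sum-remove {i = i} f))
    (0≤⇒≤ (sum rest) (sum-nonneg λ k → 0≤f (punchIn i k)) (lemma (f i) (sum rest)))
    where
    rest : Fin m → ℤ
    rest k = f (punchIn i k)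
    lemma : ∀ x y → x + y - x ≡ y
    lemma = ℤRing.solve-∀

two-terms≤sum : ∀ {m} (f : Fin m → ℤ) → (∀ i → 0ℤ ≤ f i) → ∀ {i j} → i ≢ j → f i + f j ≤ sum f
two-terms≤sum {suc zero} f _ {zero} {zero} i≢j = contradiction refl i≢j
two-terms≤sum {suc (suc m)} f 0≤f {i} {j} i≢j = subst (f i + f j ≤_) (sym (sum-remove {i = i} f))
  (ℤ.+-monoʳ-≤ (f i) (subst (λ k → f k ≤ sum rest) (punchIn-punchOut i≢j)
    (term≤sum rest (λ k → 0≤f (punchIn i k)) (punchOut i≢j))))
  where
  rest : Fin (suc m) → ℤ
  rest k = f (punchIn i k)

sum≢0⇒term≢0 : ∀ {m} (f : Fin m → ℤ) → sum f ≢ 0ℤ → ∃[ i ] f i ≢ 0ℤ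
sum≢0⇒term≢0 f sum≢0 = decidable-stable (any? λ i → ¬? (f i ℤ.≟ 0ℤ)) λ none →
  sum≢0 (sum-zero λ i → decidable-stable (f i ℤ.≟ 0ℤ) λ fi≢0 → none (i , fi≢0))

sum≡0⇒term≡0 : ∀ {m} {f : Fin m → ℤ} → (∀ i → 0ℤ ≤ f i) → sum f ≡ 0ℤ → ∀ i → f i ≡ 0ℤ
sum≡0⇒term≡0 {suc m} {f} 0≤f e i = ℤ.≤-antisym (subst (f i ≤_) e (term≤sum f 0≤f i)) (0≤f i)

-- Degrees and common neighbours

-- s u v is the number of common neighbours of u and v; in particular s u u is
-- the degree of u.
module Counting (G : Graph) where
  open Graph G
  open Adjacency G public

  a-01 : ∀ u v → a u v ≡ 0ℤ ⊎ a u v ≡ + 1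
  a-01 u v with u ~? v
  ... | yes _ = inj₂ refl
  ... | no _  = inj₁ refl

  a-nonneg : ∀ u v → 0ℤ ≤ a u v
  a-nonneg u v with u ~? v
  ... | yes _ = +≤+ z≤n
  ... | no _  = +≤+ z≤n

  a≢0⇒~ : ∀ {u v} → a u v ≢ 0ℤ → u ~ v
  a≢0⇒~ {u} {v} a≢0 with u ~? v
  ... | yes e = e
  ... | no _  = contradiction refl a≢0

  ~⇒≢ : ∀ {u v} → u ~ v → u ≢ v
  ~⇒≢ u~v u≡v = ~-irrefl u≡v u~v

  path-nonneg : ∀ u v k → 0ℤ ≤ a u k * a k v
  path-nonneg u v k = *-nonneg (a-nonneg u k) (a-nonneg k v)

  path≡1 : ∀ {u k v} → u ~ k → k ~ v → a u k * a k v ≡ + 1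
  path≡1 u~k k~v = cong₂ _*_ (a-yes u~k) (a-yes k~v)

  s-sym : ∀ u v → s u v ≡ s v u
  s-sym u v = sum-cong λ k → trans (ℤ.*-comm (a u k) (a k v)) (cong₂ _*_ (a-sym k v) (a-sym u k))

  s-nonneg : ∀ u v → 0ℤ ≤ s u v
  s-nonneg u v = sum-nonneg (path-nonneg u v)

  1≤s : ∀ {u v} k → u ~ k → k ~ v → + 1 ≤ s u v
  1≤s {u} {v} k u~k k~v = ≢0⇒1≤ (s-nonneg u v) λ s≡0 →
    contradiction (trans (sym (path≡1 u~k k~v)) (sum≡0⇒term≡0 (path-nonneg u v) s≡0 k)) λ ()

  2≤s : ∀ {u v k l} → k ≢ l → u ~ k → k ~ v → u ~ l → l ~ v → + 2 ≤ s u v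
  2≤s {u} {v} k≢l u~k k~v u~l l~v =
    subst (_≤ s u v) (cong₂ _+_ (path≡1 u~k k~v) (path≡1 u~l l~v)) (two-terms≤sum _ (path-nonneg u v) k≢l)

  common-neighbour : ∀ {u v} → s u v ≢ 0ℤ → ∃[ k ] (u ~ k × k ~ v)
  common-neighbour {u} {v} s≢0 with sum≢0⇒term≢0 (λ k → a u k * a k v) s≢0
  ... | k , t≢0 = k , a≢0⇒~ (λ e → t≢0 (cong (_* a k v) e))
                    , a≢0⇒~ (λ e → t≢0 (trans (cong (a u k *_) e) (ℤ.*-zeroʳ (a u k))))

  common-neighbour-unique : ∀ {u v k l} → s u v ≡ + 1 → u ~ k → k ~ v → u ~ l → l ~ v → k ≡ l
  common-neighbour-unique {u} {v} {k} {l} s≡1 u~k k~v u~l l~v = decidable-stable (k ≟ l) λ k≢l →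
    contradiction (subst (+ 2 ≤_) s≡1 (2≤s k≢l u~k k~v u~l l~v)) λ { (+≤+ (s≤s ())) }

  private
    -- The indicator of the neighbours of u that are not neighbours of v. Its sum is the degree of u
    -- minus the number of common neighbours.
    gap : ∀ u v k → ℤ
    gap u v k = a u k * a k u - a u k * a k v

    gap-no : ∀ {u v k} → u ~ k → ¬ k ~ v → gap u v k ≡ + 1
    gap-no {u} {v} {k} u~k k≁v = cong₂ _-_ (path≡1 u~k (~-sym u~k)) (trans (cong (a u k *_) (a-no k≁v)) (ℤ.*-zeroʳ (a u k)))

    gap-yes : ∀ {u v k} → u ~ k → k ~ v → gap u v k ≡ 0ℤ
    gap-yes u~k k~v = cong₂ _-_ (path≡1 u~k (~-sym u~k)) (path≡1 u~k k~v)

    gap-non : ∀ {u v k} → ¬ u ~ k → gap u v k ≡ 0ℤ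
    gap-non {u} {v} {k} u≁k = cong₂ (λ x y → x * a k u - y * a k v) (a-no u≁k) (a-no u≁k)

    gap-nonneg : ∀ u v k → 0ℤ ≤ gap u v k
    gap-nonneg u v k = cases (u ~? k) (k ~? v)
      where
      cases : Dec (u ~ k) → Dec (k ~ v) → 0ℤ ≤ gap u v k
      cases (no u≁k)  _         = ℤ.≤-reflexive (sym (gap-non u≁k))
      cases (yes u~k) (yes k~v) = ℤ.≤-reflexive (sym (gap-yes u~k k~v))
      cases (yes u~k) (no k≁v)  = subst (0ℤ ≤_) (sym (gap-no u~k k≁v)) (+≤+ z≤n)

    sum-gap : ∀ u v → sum (gap u v) ≡ s u u - s u v
    sum-gap u v = sum-minus (λ k → a u k * a k u) (λ k → a u k * a k v)

  two-neighbours-missed : ∀ {u v k l} → k ≢ l → u ~ k → ¬ k ~ v → u ~ l → ¬ l ~ v → + 2 ≤ s u u - s u v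
  two-neighbours-missed {u} {v} k≢l u~k k≁v u~l l≁v = subst (+ 2 ≤_) (sum-gap u v)
    (subst (_≤ sum (gap u v)) (cong₂ _+_ (gap-no u~k k≁v) (gap-no u~l l≁v)) (two-terms≤sum (gap u v) (gap-nonneg u v) k≢l))

  neighbours-⊆ : ∀ {u v} → (∀ k → u ~ k → k ~ v) → s u v ≡ s u u
  neighbours-⊆ {u} {v} u⊆v = sym (ℤ.i-j≡0⇒i≡j _ _ (trans (sym (sum-gap u v)) (sum-zero gap≡0)))
    where
    gap≡0 : ∀ k → gap u v k ≡ 0ℤ
    gap≡0 k = cases (u ~? k)
      where
      cases : Dec (u ~ k) → gap u v k ≡ 0ℤ
      cases (yes u~k) = gap-yes u~k (u⊆v k u~k)
      cases (no u≁k)  = gap-non u≁k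

  -- The vertex v is itself a neighbour of u that is not adjacent to v, and by assumption it is the
  -- only one.
  misses-one : ∀ {u v} → u ~ v → (∀ k → u ~ k → k ≢ v → k ~ v) → s u u - s u v ≡ + 1
  misses-one {u} {v} u~v dom = trans (sym (sum-gap u v))
    (trans (sum-single (gap u v) v λ k k≢v → cases k k≢v (u ~? k)) (gap-no u~v (~-irrefl refl)))
    where
    cases : ∀ k → k ≢ v → Dec (u ~ k) → gap u v k ≡ 0ℤ
    cases k k≢v (yes u~k) = gap-yes u~k (dom k u~k k≢v)
    cases k k≢v (no u≁k)  = gap-non u≁k

  other-neighbour : ∀ {u} v → + 2 ≤ s u u → ∃[ w ] (u ~ w × w ≢ v)
  other-neighbour {u} v 2≤ = decidable-stable (any? λ w → (u ~? w) ×-dec ¬? (w ≟ v)) λ none →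
    contradiction (subst (+ 2 ≤_) (sum-single (λ k → a u k * a k u) v λ k k≢v →
      cong (_* a k u) (a-no λ u~k → none (k , u~k , k≢v))) 2≤) (small (a-01 u v) (a-01 v u))
    where
    small : ∀ {x y} → x ≡ 0ℤ ⊎ x ≡ + 1 → y ≡ 0ℤ ⊎ y ≡ + 1 → ¬ + 2 ≤ x * y
    small (inj₁ refl) _           (+≤+ ())
    small (inj₂ refl) (inj₁ refl) (+≤+ ())
    small (inj₂ refl) (inj₂ refl) (+≤+ (s≤s ()))

  b-diag : ∀ u → b u u ≡ s u u - + 1
  b-diag u = cong (s u u -_) (I-diag u)

  b-off : ∀ {u v} → u ≢ v → b u v ≡ s u v
  b-off {u} {v} u≢v = trans (cong (s u v -_) (I-off u≢v)) (ℤ.+-identityʳ (s u v))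

  I-sym : ∀ (u v : Vertex) → I u v ≡ I v u
  I-sym u v with u ≟ v
  ... | yes refl = sym (I-diag u)
  ... | no u≢v   = sym (I-off (u≢v ∘ sym))

  b-sym : ∀ u v → b u v ≡ b v u
  b-sym u v = cong₂ _-_ (s-sym u v) (I-sym u v)

-- Plane geometry of a Gram matrix of rank two

*-cancel-nonneg : ∀ {d x} → 0ℤ ≤ d → d ≢ 0ℤ → 0ℤ ≤ d * x → 0ℤ ≤ x
*-cancel-nonneg {+ zero}      _ d≢0 _ = contradiction refl d≢0
*-cancel-nonneg {+ suc k} {x} _ _   h = ℤ.*-cancelˡ-≤-pos 0ℤ x (+ suc k) (subst (_≤ + suc k * x) (sym (ℤ.*-zeroʳ (+ suc k))) h)

*-cancel-≡ : ∀ {d x y} → d ≢ 0ℤ → d * x ≡ d * y → x ≡ y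
*-cancel-≡ {d} {x} {y} d≢0 e = ℤ.i-j≡0⇒i≡j x y (integral-domain d≢0 (trans (lemma d x y) (ℤ.i≡j⇒i-j≡0 e)))
  where
  lemma : ∀ d x y → d * (x - y) ≡ d * x - d * y
  lemma = ℤRing.solve-∀

square-zero : ∀ {x} → x * x ≡ 0ℤ → x ≡ 0ℤ
square-zero {x} e with ℤ.i*j≡0⇒i≡0∨j≡0 x e
... | inj₁ x≡0 = x≡0
... | inj₂ x≡0 = x≡0

private
  cofactor-lemma : ∀ D x y z w → D * (D * (x * y - z * w)) ≡ (D * x) * (D * y) - (D * z) * (D * w)
  cofactor-lemma = ℤRing.solve-∀

  -- (A B - q²) times the inner product of two vectors of a plane, in terms of
  -- their inner products (i , j) and (i′ , j′) with a basis whose Gram matrix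
  -- has diagonal A, B and off-diagonal entry q.
  form : ℤ → ℤ → ℤ → ℤ → ℤ → ℤ → ℤ → ℤ
  form A B q i j i′ j′ = i * (B * i′ - q * j′) + j * (A * j′ - q * i′)

  -- Multiplicativity of determinants. The four values of `form` are the product of the coordinates
  -- of z and w, the adjugate of the Gram matrix of the basis, and the coordinates of p and r.
  form-minor : ∀ A B q iz jz iw jw ip jp ir jr →
    (iz * (B * ip - q * jp) + jz * (A * jp - q * ip)) * (iw * (B * ir - q * jr) + jw * (A * jr - q * ir)) -
    (iz * (B * ir - q * jr) + jz * (A * jr - q * ir)) * (iw * (B * ip - q * jp) + jw * (A * jp - q * ip))
    ≡ (A * B - q * q) * ((iz * jw - jz * iw) * (ip * jr - jp * ir))
  form-minor A B q iz jz iw jw ip jp ir jr = trans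
    (outer iz jz iw jw (B * ip - q * jp) (A * jp - q * ip) (B * ir - q * jr) (A * jr - q * ir))
    (trans (cong ((iz * jw - jz * iw) *_) (inner A B q ip jp ir jr))
      (swap (iz * jw - jz * iw) (A * B - q * q) (ip * jr - jp * ir)))
    where
    outer : ∀ i j i′ j′ x y x′ y′ → (i * x + j * y) * (i′ * x′ + j′ * y′) - (i * x′ + j * y′) * (i′ * x + j′ * y)
            ≡ (i * j′ - j * i′) * (x * y′ - x′ * y)
    outer = ℤRing.solve-∀
    inner : ∀ A B q i j i′ j′ → (B * i - q * j) * (A * j′ - q * i′) - (B * i′ - q * j′) * (A * j - q * i)
            ≡ (A * B - q * q) * (i * j′ - j * i′)
    inner = ℤRing.solve-∀
    swap : ∀ x y z → x * (y * z) ≡ y * (x * z)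
    swap = ℤRing.solve-∀

module Gram {N : ℕ} (b : Mat N N) (b-sym : ∀ u v → b u v ≡ b v u) (b-nonneg : ∀ u v → 0ℤ ≤ b u v)
  (rank₂ : ∀ u v z w → (b u u * b v v - b u v * b v u) * b z w ≡
             b z u * (b v v * b u w - b u v * b v w) + b z v * (b u u * b v w - b v u * b u w)) where

  minor : Fin N → Fin N → Fin N → Fin N → ℤ
  minor z w p r = b z p * b w r - b z r * b w p

  Δ : Fin N → Fin N → ℤ
  Δ u v = minor u v u v

  infix 4 _∥_ _∦_
  _∥_ _∦_ : Fin N → Fin N → Set
  u ∥ v = Δ u v ≡ 0ℤ
  u ∦ v = ¬ u ∥ v

  Δ-sym : ∀ u v → Δ u v ≡ Δ v u
  Δ-sym u v = cong₂ _-_ (ℤ.*-comm (b u u) (b v v)) (ℤ.*-comm (b u v) (b v u))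

  ∥-sym : ∀ {u v} → u ∥ v → v ∥ u
  ∥-sym {u} {v} = trans (Δ-sym v u)

  -- That is, u spans an extreme ray of the cone generated by the Gram vectors.
  Extreme : Fin N → Set
  Extreme u = ∀ (w : Fin N → ℤ) m → (∀ z → 0ℤ ≤ w z) →
    (∀ x → sum (λ z → w z * b z x) ≡ m * b u x) → ∀ z → w z ≢ 0ℤ → z ∥ u

  module Basis (u v : Fin N) (0≤D : 0ℤ ≤ Δ u v) (u∦v : u ∦ v) where
    D = Δ u v

    -- In the plane this is the oriented area of z and w times that of u and v. So it measures
    -- angles between vectors through their inner products with the basis.
    cross : Fin N → Fin N → ℤ
    cross z w = b z u * b w v - b z v * b w u

    coordinates : ∀ z w → D * b z w ≡ form (b u u) (b v v) (b u v) (b z u) (b z v) (b w u) (b w v)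
    coordinates z w = trans (rank₂ u v z w) (cong₂ _+_
      (cong (b z u *_) (cong₂ (λ x y → b v v * x - b u v * y) (b-sym u w) (b-sym v w)))
      (cong (b z v *_) (cong₂ _-_ (cong (b u u *_) (b-sym v w)) (cong₂ _*_ (b-sym v u) (b-sym u w)))))

    -- Multiplied by one more `D`, every inner product can be replaced by its coordinates;
    -- `form-minor` then factors the result and the additional `D` cancels.
    D*minor : ∀ z w p r → D * minor z w p r ≡ cross z w * cross p r
    D*minor z w p r = *-cancel-≡ u∦v (trans (cofactor-lemma D (b z p) (b w r) (b z r) (b w p))
      (trans (cong₂ _-_ (cong₂ _*_ (coordinates z p) (coordinates w r)) (cong₂ _*_ (coordinates z r) (coordinates w p)))
      (trans (form-minor (b u u) (b v v) (b u v) (b z u) (b z v) (b w u) (b w v) (b p u) (b p v) (b r u) (b r v))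
        (cong (λ t → (b u u * b v v - b u v * t) * (cross z w * cross p r)) (b-sym u v)))))

    -- The Cauchy-Schwarz inequality: `D` times this determinant is the square of `cross z w`.
    Δ-nonneg : ∀ z w → 0ℤ ≤ Δ z w
    Δ-nonneg z w = *-cancel-nonneg 0≤D u∦v (subst (0ℤ ≤_) (sym (D*minor z w z w)) (square-nonneg (cross z w)))

    ∥⇒cross≡0 : ∀ {z w} → z ∥ w → cross z w ≡ 0ℤ
    ∥⇒cross≡0 {z} {w} z∥w = square-zero (trans (sym (D*minor z w z w)) (trans (cong (D *_) z∥w) (ℤ.*-zeroʳ D)))

    cross≡0⇒∥ : ∀ {z w} → cross z w ≡ 0ℤ → z ∥ w
    cross≡0⇒∥ {z} {w} e = integral-domain u∦v (trans (D*minor z w z w) (cong (_* cross z w) e))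

    null : ∀ {z} → b z z ≡ 0ℤ → ∀ w → b z w ≡ 0ℤ
    null {z} e w = square-zero (ℤ.≤-antisym
      (0≤⇒≤ _ (Δ-nonneg z w) (cong₂ (λ x y → x * b w w - b z w * y) (sym e) (b-sym z w)))
      (square-nonneg (b z w)))

    coordinate≢0 : ∀ {z} → b z z ≢ 0ℤ → b z u ≢ 0ℤ ⊎ b z v ≢ 0ℤ
    coordinate≢0 {z} nz with b z u ℤ.≟ 0ℤ | b z v ℤ.≟ 0ℤ
    ... | no i≢0 | _      = inj₁ i≢0
    ... | _      | no j≢0 = inj₂ j≢0
    ... | yes i≡0 | yes j≡0 = contradiction (integral-domain u∦v (trans (coordinates z z)
      (cong₂ (λ i j → form (b u u) (b v v) (b u v) i j (b z u) (b z v)) i≡0 j≡0))) nz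

    private
      -- The three-term Plücker relation. The coordinates in it are nonnegative, so when `b x u` is
      -- nonzero the signs of the areas of z, x and of x, y decide that of z, y.
      plückerᵤ : ∀ x z y → b x u * cross z y ≡ b z u * cross x y + b y u * cross z x
      plückerᵤ x z y = lemma (b x u) (b x v) (b z u) (b z v) (b y u) (b y v)
        where
        lemma : ∀ i j i′ j′ i″ j″ → i * (i′ * j″ - j′ * i″) ≡ i′ * (i * j″ - j * i″) + i″ * (i′ * j - j′ * i)
        lemma = ℤRing.solve-∀

      plückerᵥ : ∀ x z y → b x v * cross z y ≡ b z v * cross x y + b y v * cross z x
      plückerᵥ x z y = lemma (b x u) (b x v) (b z u) (b z v) (b y u) (b y v)
        where
        lemma : ∀ i j i′ j′ i″ j″ → j * (i′ * j″ - j′ * i″) ≡ j′ * (i * j″ - j * i″) + j″ * (i′ * j - j′ * i)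
        lemma = ℤRing.solve-∀

    -- The zero vector is parallel to every vector, hence the condition on the middle one. A nonzero
    -- x has a nonzero coordinate, by which a Plücker relation can be cancelled.
    ∥-trans : ∀ {z x y} → b x x ≢ 0ℤ → z ∥ x → x ∥ y → z ∥ y
    ∥-trans {z} {x} {y} nz z∥x x∥y = cross≡0⇒∥ (case (coordinate≢0 nz))
      where
      zero-rhs : ∀ s t → s * cross x y + t * cross z x ≡ 0ℤ
      zero-rhs s t = trans (cong₂ (λ α β → s * α + t * β) (∥⇒cross≡0 x∥y) (∥⇒cross≡0 z∥x))
        (cong₂ _+_ (ℤ.*-zeroʳ s) (ℤ.*-zeroʳ t))
      case : b x u ≢ 0ℤ ⊎ b x v ≢ 0ℤ → cross z y ≡ 0ℤ
      case (inj₁ i≢0) = integral-domain i≢0 (trans (plückerᵤ x z y) (zero-rhs (b z u) (b y u)))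
      case (inj₂ j≢0) = integral-domain j≢0 (trans (plückerᵥ x z y) (zero-rhs (b z v) (b y v)))

    infix 4 _≼_
    -- The order of directions by angle. It has no cycles through different directions because all
    -- vectors have nonnegative inner products with u and v.
    _≼_ : Fin N → Fin N → Set
    z ≼ w = 0ℤ ≤ cross z w

    ≼-trans : ∀ {z x y} → b x x ≢ 0ℤ → z ≼ x → x ≼ y → z ≼ y
    ≼-trans {z} {x} {y} nz z≼x x≼y = case (coordinate≢0 nz)
      where
      case : b x u ≢ 0ℤ ⊎ b x v ≢ 0ℤ → z ≼ y
      case (inj₁ i≢0) = *-cancel-nonneg (b-nonneg x u) i≢0 (subst (0ℤ ≤_) (sym (plückerᵤ x z y))
        (+-nonneg (*-nonneg (b-nonneg z u) x≼y) (*-nonneg (b-nonneg y u) z≼x)))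
      case (inj₂ j≢0) = *-cancel-nonneg (b-nonneg x v) j≢0 (subst (0ℤ ≤_) (sym (plückerᵥ x z y))
        (+-nonneg (*-nonneg (b-nonneg z v) x≼y) (*-nonneg (b-nonneg y v) z≼x)))

    ≼-total : ∀ z w → z ≼ w ⊎ w ≼ z
    ≼-total z w with ℤ.≤-total 0ℤ (cross z w)
    ... | inj₁ h = inj₁ h
    ... | inj₂ h = inj₂ (subst (0ℤ ≤_) (lemma (b z u) (b z v) (b w u) (b w v)) (ℤ.neg-mono-≤ h))
      where
      lemma : ∀ i j i′ j′ → ℤ.- (i * j′ - j * i′) ≡ i′ * j - j′ * i
      lemma = ℤRing.solve-∀

    null-≼ : ∀ {z} w → b z z ≡ 0ℤ → z ≼ w
    null-≼ {z} w e = ℤ.≤-reflexive (sym (cong₂ (λ i j → i * b w v - j * b w u) (null e u) (null e v)))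

    -- A linear search that starts from the candidate u. Zero vectors are passed over: they lie
    -- below everything, but could not serve as the middle term in `≼-trans`.
    ≼-maximum : b u u ≢ 0ℤ → ∃[ x ] (b x x ≢ 0ℤ × ∀ z → z ≼ x)
    ≼-maximum nzu = go N id
      where
      go : ∀ k (f : Fin k → Fin N) → ∃[ x ] (b x x ≢ 0ℤ × ∀ i → f i ≼ x)
      go zero    f = u , nzu , λ ()
      go (suc k) f with go k (f ∘ suc)
      ... | x , nz , max with b (f zero) (f zero) ℤ.≟ 0ℤ | ≼-total (f zero) x
      ...   | yes e | _        = x , nz , λ { zero → null-≼ x e ; (suc i) → max i }
      ...   | no _  | inj₁ f≼x = x , nz , λ { zero → f≼x ; (suc i) → max i }
      ...   | no nf | inj₂ x≼f = f zero , nf , λ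
        { zero    → ℤ.≤-reflexive (sym (∥⇒cross≡0 (ℤ.+-inverseʳ (b (f zero) (f zero) * b (f zero) (f zero)))))
        ; (suc i) → ≼-trans nz (max i) x≼f }

    -- The linear functional `cross z x` is nonnegative on all vectors z and vanishes at x. Applied
    -- to a nonnegative combination equal to a multiple of x, it makes every term vanish.
    maximum⇒extreme : ∀ {x} → (∀ z → z ≼ x) → Extreme x
    maximum⇒extreme {x} max w m 0≤w e z wz≢0 =
      cross≡0⇒∥ (integral-domain wz≢0 (sum≡0⇒term≡0 (λ z → *-nonneg (0≤w z) (max z)) total z))
      where
      total : sum (λ z → w z * cross z x) ≡ 0ℤ
      total = trans (sum-cong λ z → lemma₁ (w z) (b z u) (b z v) (b x u) (b x v))
        (trans (sum-minus (λ z → w z * b z u * b x v) (λ z → w z * b z v * b x u))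
        (trans (cong₂ _-_ (trans (sym (*-distribʳ-sum (b x v) λ z → w z * b z u)) (cong (_* b x v) (e u)))
                          (trans (sym (*-distribʳ-sum (b x u) λ z → w z * b z v)) (cong (_* b x u) (e v))))
          (lemma₂ m (b x u) (b x v))))
        where
        lemma₁ : ∀ w i j i′ j′ → w * (i * j′ - j * i′) ≡ w * i * j′ - w * j * i′
        lemma₁ = ℤRing.solve-∀
        lemma₂ : ∀ m i j → m * i * j - m * j * i ≡ 0ℤ
        lemma₂ = ℤRing.solve-∀

    extreme-ray : b u u ≢ 0ℤ → ∃[ x ] (b x x ≢ 0ℤ × (∀ z → z ≼ x) × ∀ y → b y y ≢ 0ℤ → y ∥ x → Extreme y)
    extreme-ray nzu with ≼-maximum nzu
    ... | x , nz , max = x , nz , max , λ y _ y∥x → maximum⇒extreme λ z →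
      ≼-trans nz (max z) (ℤ.≤-reflexive (sym (∥⇒cross≡0 (∥-sym {y} {x} y∥x))))

  -- The two rays are the ends of the angular order. If they coincided, every vector would be
  -- parallel to both, including u and v.
  extreme-rays : ∀ u v → 0ℤ ≤ Δ u v → u ∦ v → b u u ≢ 0ℤ → b v v ≢ 0ℤ →
    ∃[ x ] ∃[ y ] (b x x ≢ 0ℤ × b y y ≢ 0ℤ × x ∦ y ×
      (∀ z → b z z ≢ 0ℤ → z ∥ x → Extreme z) × (∀ z → b z z ≢ 0ℤ → z ∥ y → Extreme z))
  extreme-rays u v 0≤D u∦v nzu nzv =
    x , y , nzx , nzy , x∦y , proj₂ (proj₂ (proj₂ xs)) , proj₂ (proj₂ (proj₂ ys))
    where
    open Basis u v 0≤D u∦v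
    -- Exchanging the basis vectors changes the sign of `cross`, so a maximum here is a minimum of
    -- the original order.
    module Flipped = Basis v u (subst (0ℤ ≤_) (Δ-sym u v) 0≤D) (u∦v ∘ ∥-sym {v} {u})
    xs = extreme-ray nzu
    ys = Flipped.extreme-ray nzv
    x  = proj₁ xs
    y  = proj₁ ys
    nzx : b x x ≢ 0ℤ
    nzx = proj₁ (proj₂ xs)
    nzy : b y y ≢ 0ℤ
    nzy = proj₁ (proj₂ ys)
    ∥y : x ∥ y → ∀ z → z ∥ y
    ∥y x∥y z = cross≡0⇒∥ {z} {y} (ℤ.≤-antisym
      (0≤⇒≤ (Flipped.cross z y) (proj₁ (proj₂ (proj₂ ys)) z) (lemma (b z u) (b z v) (b y u) (b y v)))
      (≼-trans {z} {x} {y} nzx (proj₁ (proj₂ (proj₂ xs)) z) (ℤ.≤-reflexive (sym (∥⇒cross≡0 {x} {y} x∥y)))))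
      where
      lemma : ∀ i j i′ j′ → 0ℤ - (i * j′ - j * i′) ≡ j * i′ - i * j′
      lemma = ℤRing.solve-∀
    x∦y : x ∦ y
    x∦y x∥y = u∦v (∥-trans {u} {y} {v} nzy (∥y x∥y u) (∥-sym {v} {y} (∥y x∥y v)))

positive-term : ∀ {m} (f : Fin m → ℤ) → + 1 ≤ sum f → ∃[ i ] + 1 ≤ f i
positive-term {m} f 1≤ = decidable-stable (any? λ i → + 1 ℤ.≤? f i) λ none →
  contradiction (ℤ.≤-trans 1≤ (subst (sum f ≤_) (sum-zero {m} {λ _ → 0ℤ} λ _ → refl)
    (sum-mono λ i → ℤ.i<j⇒i≤pred[j] (ℤ.≰⇒> λ 1≤f → none (i , 1≤f))))) λ { (+≤+ ()) }

-- The Gram vectors of a graph with the spectral facts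

module Geometry (n : ℕ) (G : Graph) (facts : SpectralFacts n G) (m≢0 : + (n ℕ.* 2) ≢ 0ℤ) where
  open Graph G
  open Counting G public
  open SpectralFacts facts public

  m : ℤ
  m = + (n ℕ.* 2)

  -- For an isolated u, row u of A is zero, and the diagonal entry of `s⊗b` at u would read 0 = 0 +
  -- m (0 - 1).
  no-isolated : ∀ u → + 1 ≤ s u u
  no-isolated u = ≢0⇒1≤ (s-nonneg u u) λ s≡0 → m≢0 (m≡0 s≡0)
    where
    module _ (s≡0 : s u u ≡ 0ℤ) where
      a≡0 : ∀ k → a u k ≡ 0ℤ
      a≡0 k = decidable-stable (a u k ℤ.≟ 0ℤ) λ a≢0 →
        1≤⇒≢0 (1≤s k (a≢0⇒~ a≢0) (~-sym (a≢0⇒~ a≢0))) s≡0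
      row≡0 : ∀ (x : Vertex → ℤ) → sum (λ k → a u k * x k) ≡ 0ℤ
      row≡0 x = sum-zero λ k → cong (_* x k) (a≡0 k)
      m≡0 : m ≡ 0ℤ
      m≡0 = integral-domain {+ 1} (λ ()) (ℤ.neg-injective (trans (lemma m) (trans
        (sym (cong₂ (λ x y → x + m * y) (row≡0 λ k → b k u) (trans (b-diag u) (cong (_- + 1) s≡0))))
        (trans (sym (s⊗b u u)) (sum-zero λ k → cong (_* b k u) (row≡0 λ l → a l k))))))
        where
        lemma : ∀ m → ℤ.- (+ 1 * m) ≡ 0ℤ + m * (0ℤ - + 1)
        lemma = ℤRing.solve-∀

  b-nonneg : ∀ u v → 0ℤ ≤ b u v
  b-nonneg u v = cases (u ≟ v)
    where
    cases : Dec (u ≡ v) → 0ℤ ≤ b u v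
    cases (yes refl) = subst (0ℤ ≤_) (sym (b-diag u)) (≤⇒0≤ (no-isolated u))
    cases (no u≢v)   = subst (0ℤ ≤_) (sym (b-off u≢v)) (s-nonneg u v)

  open Gram b b-sym b-nonneg rank₂ public

  -- Equivalently, u has degree at least two.
  NonNull : Vertex → Set
  NonNull u = b u u ≢ 0ℤ

  degree≡ : ∀ u → s u u ≡ b u u + + 1
  degree≡ u = trans (lemma (s u u)) (cong (_+ + 1) (sym (b-diag u)))
    where
    lemma : ∀ x → x ≡ x - + 1 + + 1
    lemma = ℤRing.solve-∀

  2≤degree : ∀ {u} → NonNull u → + 2 ≤ s u u
  2≤degree {u} nz = subst (+ 2 ≤_) (sym (degree≡ u)) (ℤ.+-monoˡ-≤ (+ 1) (≢0⇒1≤ (b-nonneg u u) nz))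

  -- All neighbours of u other than v are common neighbours, which makes deg u - 1 of them; this is
  -- also the squared length of u.
  dominated : ∀ {u v} → u ~ v → (∀ k → u ~ k → k ≢ v → k ~ v) → b u v ≡ b u u
  dominated {u} {v} u~v dom = trans (b-off (~⇒≢ u~v)) (trans (lemma (s u u) (s u v))
    (trans (cong (λ x → s u u - x) (misses-one u~v dom)) (sym (b-diag u))))
    where
    lemma : ∀ x y → y ≡ x - (x - y)
    lemma = ℤRing.solve-∀

  -- In `trace₁` the mixed terms vanish. Divided by the squared lengths, this is the trace of A in
  -- an orthogonal basis.
  orthogonal-trace : ∀ {u v} → b u v ≡ 0ℤ → b v v * p u u + b u u * p v v ≡ b u u * b v v
  orthogonal-trace {u} {v} e = trans (lemma (b v v * p u u + b u u * p v v) (p v u) (p u v))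
    (trans (sym (cong₂ (λ x y → b v v * p u u + b u u * p v v - (x * p v u + y * p u v)) e (trans (b-sym v u) e)))
    (trans (trace₁ u v) (trans (cong (λ x → b u u * b v v - x * b v u) e) (lemma′ (b u u * b v v) (b v u)))))
    where
    lemma : ∀ x y z → x ≡ x - (0ℤ * y + 0ℤ * z)
    lemma = ℤRing.solve-∀
    lemma′ : ∀ x y → x - 0ℤ * y ≡ x
    lemma′ = ℤRing.solve-∀

  -- Inner products expanded in the orthogonal basis u, v, with denominators cleared.
  orthogonal-coordinates : ∀ {u v} → b u v ≡ 0ℤ → ∀ z w →
    b u u * b v v * b z w ≡ b v v * (b z u * b w u) + b u u * (b z v * b w v)
  orthogonal-coordinates {u} {v} e z w = trans
    (trans (lemma (b u u) (b v v) (b z w) (b v u)) (cong (λ x → (b u u * b v v - x * b v u) * b z w) (sym e)))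
    (trans (rank₂ u v z w)
    (trans (cong₂ (λ x y → b z u * (b v v * b u w - x * b v w) + b z v * (b u u * b v w - y * b u w)) e (trans (b-sym v u) e))
    (trans (lemma′ (b z u) (b z v) (b v v) (b u u) (b u w) (b v w))
      (cong₂ (λ x y → b v v * (b z u * x) + b u u * (b z v * y)) (b-sym u w) (b-sym v w)))))
    where
    lemma : ∀ x y z w → x * y * z ≡ (x * y - 0ℤ * w) * z
    lemma = ℤRing.solve-∀
    lemma′ : ∀ i j B A x y → i * (B * x - 0ℤ * y) + j * (A * y - 0ℤ * x) ≡ B * (i * x) + A * (j * y)
    lemma′ = ℤRing.solve-∀

  -- There are m + 1 vertices, so u has a single non-neighbour, which is u itself.
  full-degree : ∀ {u} → s u u ≡ m → ∀ v → v ≢ u → u ~ v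
  full-degree {u} s≡m v v≢u = decidable-stable (u ~? v) λ u≁v →
    contradiction (subst (+ 2 ≤_) total
      (subst (_≤ sum f) (cong₂ _+_ (missing (~-irrefl refl)) (missing u≁v))
        (two-terms≤sum f f-nonneg (v≢u ∘ sym)))) λ { (+≤+ (s≤s ())) }
    where
    f : Vertex → ℤ
    f k = + 1 - a u k * a k u
    missing : ∀ {k} → ¬ u ~ k → f k ≡ + 1
    missing {k} u≁k = cong (λ x → + 1 - x * a k u) (a-no u≁k)
    f-nonneg : ∀ k → 0ℤ ≤ f k
    f-nonneg k = cases (u ~? k)
      where
      cases : Dec (u ~ k) → 0ℤ ≤ f k
      cases (yes u~k) = ℤ.≤-reflexive (sym (cong (λ x → + 1 - x) (path≡1 u~k (~-sym u~k))))
      cases (no u≁k)  = subst (0ℤ ≤_) (sym (missing u≁k)) (+≤+ z≤n)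
    total : sum f ≡ + 1
    total = trans (sum-minus (λ _ → + 1) (λ k → a u k * a k u))
      (trans (cong₂ _-_ (trans (sum-const order (+ 1)) (trans (ℤ.*-identityʳ (+ order)) (cong +_ order≡))) s≡m)
      (lemma m))
      where
      lemma : ∀ m → + 1 + m - m ≡ + 1
      lemma = ℤRing.solve-∀

-- Recognising cycles of length four and five

module Cycles (G : Graph) where
  open Graph G

  -- Consecutive vertices differ by irreflexivity, so only the ends of the five diagonals are
  -- assumed distinct.
  C₅-subgraph : ∀ {a b c d e} → a ~ b → b ~ c → c ~ d → d ~ e → e ~ a →
                a ≢ c → a ≢ d → b ≢ d → b ≢ e → c ≢ e → HasSubgraph G C₅
  C₅-subgraph {a} {b} {c} {d} {e} ab bc cd de ea a≢c a≢d b≢d b≢e c≢e = f , injective _ _ , edges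
    where
    irr : ∀ {u v} → u ~ v → u ≢ v
    irr u~v u≡v = ~-irrefl u≡v u~v
    f : Fin 5 → Vertex
    f 0F = a
    f 1F = b
    f 2F = c
    f 3F = d
    f 4F = e
    injective : ∀ i j → f i ≡ f j → i ≡ j
    injective 0F 0F _ = refl
    injective 0F 1F q = contradiction q (irr ab)
    injective 0F 2F q = contradiction q a≢c
    injective 0F 3F q = contradiction q a≢d
    injective 0F 4F q = contradiction (sym q) (irr ea)
    injective 1F 0F q = contradiction (sym q) (irr ab)
    injective 1F 1F _ = refl
    injective 1F 2F q = contradiction q (irr bc)
    injective 1F 3F q = contradiction q b≢d
    injective 1F 4F q = contradiction q b≢e
    injective 2F 0F q = contradiction (sym q) a≢c
    injective 2F 1F q = contradiction (sym q) (irr bc)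
    injective 2F 2F _ = refl
    injective 2F 3F q = contradiction q (irr cd)
    injective 2F 4F q = contradiction q c≢e
    injective 3F 0F q = contradiction (sym q) a≢d
    injective 3F 1F q = contradiction (sym q) b≢d
    injective 3F 2F q = contradiction (sym q) (irr cd)
    injective 3F 3F _ = refl
    injective 3F 4F q = contradiction q (irr de)
    injective 4F 0F q = contradiction q (irr ea)
    injective 4F 1F q = contradiction (sym q) b≢e
    injective 4F 2F q = contradiction (sym q) c≢e
    injective 4F 3F q = contradiction (sym q) (irr de)
    injective 4F 4F _ = refl
    next : Fin 5 → Fin 5
    next 0F = 1F
    next 1F = 2F
    next 2F = 3F
    next 3F = 4F
    next 4F = 0F
    step : ∀ i → f i ~ f (next i)
    step 0F = ab
    step 1F = bc
    step 2F = cd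
    step 3F = de
    step 4F = ea
    forward : ∀ i j → toℕ j ≡ suc (toℕ i) ℕ.% 5 → f i ~ f j
    forward i j q = subst (λ k → f i ~ f k) (toℕ-injective (trans (lemma i) (sym q))) (step i)
      where
      lemma : ∀ i → toℕ (next i) ≡ suc (toℕ i) ℕ.% 5
      lemma 0F = refl
      lemma 1F = refl
      lemma 2F = refl
      lemma 3F = refl
      lemma 4F = refl
    edges : ∀ i j → Graph._~_ C₅ i j → f i ~ f j
    edges i j = [ forward i j , ~-sym ∘ forward j i ]

  induced-C₄ : ∀ {a b c d} → a ~ b → b ~ c → c ~ d → d ~ a → ¬ a ~ c → ¬ b ~ d →
               a ≢ c → b ≢ d → HasInducedSubgraph G C₄
  induced-C₄ {a} {b} {c} {d} ab bc cd da a≁c b≁d a≢c b≢d = f , injective _ _ , edges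
    where
    irr : ∀ {u v} → u ~ v → u ≢ v
    irr u~v u≡v = ~-irrefl u≡v u~v
    f : Fin 4 → Vertex
    f 0F = a
    f 1F = b
    f 2F = c
    f 3F = d
    injective : ∀ i j → f i ≡ f j → i ≡ j
    injective 0F 0F _ = refl
    injective 0F 1F q = contradiction q (irr ab)
    injective 0F 2F q = contradiction q a≢c
    injective 0F 3F q = contradiction (sym q) (irr da)
    injective 1F 0F q = contradiction (sym q) (irr ab)
    injective 1F 1F _ = refl
    injective 1F 2F q = contradiction q (irr bc)
    injective 1F 3F q = contradiction q b≢d
    injective 2F 0F q = contradiction (sym q) a≢c
    injective 2F 1F q = contradiction (sym q) (irr bc)
    injective 2F 2F _ = refl
    injective 2F 3F q = contradiction q (irr cd)
    injective 3F 0F q = contradiction q (irr da)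
    injective 3F 1F q = contradiction (sym q) b≢d
    injective 3F 2F q = contradiction (sym q) (irr cd)
    injective 3F 3F _ = refl
    both : ∀ {i j} → Graph._~_ C₄ i j → f i ~ f j → _
    both e e′ = mk⇔ (λ (_ : Graph._~_ C₄ _ _) → e′) (λ _ → e)
    none : ∀ {i j} → ¬ Graph._~_ C₄ i j → ¬ f i ~ f j → _
    none {i} {j} ¬e ¬e′ = mk⇔ (λ (e : Graph._~_ C₄ i j) → contradiction e ¬e) (λ e → contradiction e ¬e′)
    edges : ∀ i j → _
    edges 0F 0F = none (Graph.~-irrefl C₄ refl) (~-irrefl refl)
    edges 0F 1F = both (inj₁ refl) ab
    edges 0F 2F = none (λ { (inj₁ ()) ; (inj₂ ()) }) a≁c
    edges 0F 3F = both (inj₂ refl) (~-sym da)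
    edges 1F 0F = both (inj₂ refl) (~-sym ab)
    edges 1F 1F = none (Graph.~-irrefl C₄ refl) (~-irrefl refl)
    edges 1F 2F = both (inj₁ refl) bc
    edges 1F 3F = none (λ { (inj₁ ()) ; (inj₂ ()) }) b≁d
    edges 2F 0F = none (λ { (inj₁ ()) ; (inj₂ ()) }) (a≁c ∘ ~-sym)
    edges 2F 1F = both (inj₂ refl) (~-sym bc)
    edges 2F 2F = none (Graph.~-irrefl C₄ refl) (~-irrefl refl)
    edges 2F 3F = both (inj₁ refl) cd
    edges 3F 0F = both (inj₁ refl) da
    edges 3F 1F = none (λ { (inj₁ ()) ; (inj₂ ()) }) (b≁d ∘ ~-sym)
    edges 3F 2F = both (inj₂ refl) (~-sym cd)
    edges 3F 3F = none (Graph.~-irrefl C₄ refl) (~-irrefl refl)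

-- Edges between vertices of degree at least two lie in triangles

module Triangles (n : ℕ) (G : Graph) (facts : SpectralFacts n G) (m≢0 : + (n ℕ.* 2) ≢ 0ℤ) where
  open Graph G
  open Geometry n G facts m≢0
  open Cycles G

  1≤b : ∀ {u v} → u ≢ v → ∀ k → u ~ k → k ~ v → + 1 ≤ b u v
  1≤b u≢v k u~k k~v = subst (+ 1 ≤_) (sym (b-off u≢v)) (1≤s k u~k k~v)

  p≡0 : ∀ {u v} → b u v ≡ 0ℤ → (∀ w → u ~ w → w ≢ v → b w u ≡ 0ℤ) → p u u ≡ 0ℤ
  p≡0 {u} {v} buv≡0 h = sum-zero λ w → cases w (u ~? w) (w ≟ v)
    where
    cases : ∀ w → Dec (u ~ w) → Dec (w ≡ v) → a u w * b w u ≡ 0ℤ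
    cases w (no u≁w) _ = cong (_* b w u) (a-no u≁w)
    cases w (yes _) (yes refl) = trans (cong (a u w *_) (trans (b-sym w u) buv≡0)) (ℤ.*-zeroʳ (a u w))
    cases w (yes u~w) (no w≢v) = trans (cong (a u w *_) (h w u~w w≢v)) (ℤ.*-zeroʳ (a u w))

  -- The entry `p u u` sums `b w u` over the neighbours w of u. Each of the deg u - 1 neighbours
  -- other than v contributes at least one, while v contributes zero.
  p≥b : ∀ {u v} → b u v ≡ 0ℤ → (∀ w → u ~ w → w ≢ v → b w u ≢ 0ℤ) → b u u ≤ p u u
  p≥b {u} {v} buv≡0 h = subst (_≤ p u u) total (sum-mono λ w → cases w (u ~? w) (w ≟ v))
    where
    total : sum (λ w → a u w * a w u - I w v) ≡ b u u
    total = trans (sum-minus (λ w → a u w * a w u) (λ w → I w v))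
      (trans (cong (s u u -_) (trans (sum-single (λ w → I w v) v λ _ → I-off) (I-diag v))) (sym (b-diag u)))
    cases : ∀ w → Dec (u ~ w) → Dec (w ≡ v) → a u w * a w u - I w v ≤ a u w * b w u
    cases w (yes u~w) (yes refl) = ℤ.≤-reflexive (trans (cong₂ _-_ (path≡1 u~w (~-sym u~w)) (I-diag w))
      (sym (trans (cong (a u w *_) (trans (b-sym w u) buv≡0)) (ℤ.*-zeroʳ (a u w)))))
    cases w (yes u~w) (no w≢v) = subst (_≤ a u w * b w u) (sym (cong₂ _-_ (path≡1 u~w (~-sym u~w)) (I-off w≢v)))
      (subst (+ 1 ≤_) (sym (trans (cong (_* b w u) (a-yes u~w)) (ℤ.*-identityˡ (b w u))))
        (≢0⇒1≤ (b-nonneg w u) (h w u~w w≢v)))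
    cases w (no u≁w) _ = subst (_≤ a u w * b w u) (sym (cong (λ x → x * a w u - I w v) (a-no u≁w)))
      (subst (0ℤ - I w v ≤_) (sym (cong (_* b w u) (a-no u≁w)))
        (0≤⇒≤ (I w v) (I-nonneg (w ≟ v)) (lemma (I w v))))
      where
      lemma : ∀ x → 0ℤ - (0ℤ - x) ≡ x
      lemma = ℤRing.solve-∀
      I-nonneg : Dec (w ≡ v) → 0ℤ ≤ I w v
      I-nonneg (yes refl) = subst (0ℤ ≤_) (sym (I-diag w)) (+≤+ z≤n)
      I-nonneg (no w≢v)   = subst (0ℤ ≤_) (sym (I-off w≢v)) (+≤+ z≤n)

  trace-contradiction : ∀ {u v} → NonNull u → NonNull v → b u v ≡ 0ℤ → p u u ≡ 0ℤ → p v v ≡ 0ℤ → ⊥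
  trace-contradiction {u} {v} nu nv e pu pv = nv (integral-domain nu (trans (sym (orthogonal-trace e))
    (trans (cong₂ (λ x y → b v v * x + b u u * y) pu pv) (cong₂ _+_ (ℤ.*-zeroʳ (b v v)) (ℤ.*-zeroʳ (b u u))))))

  EdgesInTriangles : Set
  EdgesInTriangles = ∀ u v → u ~ v → NonNull u → NonNull v → b u v ≢ 0ℤ

  -- Let w and x be further neighbours of u and v. A common neighbour k of theirs would give the
  -- 5-cycle u, w, k, x, v, so w and x are orthogonal. In orthogonal coordinates this is a vanishing
  -- sum of two nonnegative terms. Since w and v share u, and x and u share v, it follows that w is
  -- orthogonal to u and x to v. So `p u u` and `p v v` are both zero, against the trace.
  no-C₅⇒triangles : ¬ HasSubgraph G C₅ → EdgesInTriangles
  no-C₅⇒triangles no-C₅ u v u~v nu nv buv≡0 = trace-contradiction nu nv buv≡0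
    (p≡0 buv≡0 λ w u~w w≢v → b-wu≡0 w u~w w≢v)
    (p≡0 (trans (b-sym v u) buv≡0) λ w v~w w≢u → b-wv≡0 w v~w w≢u)
    where
    s≡0 : s u v ≡ 0ℤ
    s≡0 = trans (sym (b-off (~⇒≢ u~v))) buv≡0

    no-common : ∀ {k} → u ~ k → ¬ k ~ v
    no-common {k} u~k k~v = 1≤⇒≢0 (1≤s k u~k k~v) s≡0

    far : ∀ {w x} → u ~ w → w ≢ v → v ~ x → x ≢ u → b w x ≡ 0ℤ
    far {w} {x} u~w w≢v v~x x≢u = trans (b-off w≢x) (decidable-stable (s w x ℤ.≟ 0ℤ) λ s≢0 →
      let k , w~k , k~x = common-neighbour s≢0 in
      no-C₅ (C₅-subgraph u~w w~k k~x (~-sym v~x) (~-sym u~v)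
        (λ { refl → no-common k~x (~-sym v~x) }) (x≢u ∘ sym)
        w≢x w≢v (λ { refl → no-common u~w w~k })))
      where
      w≢x : w ≢ x
      w≢x refl = no-common u~w (~-sym v~x)

    vanish : ∀ {w x} → u ~ w → w ≢ v → v ~ x → x ≢ u → b w u ≡ 0ℤ × b x v ≡ 0ℤ
    vanish {w} {x} u~w w≢v v~x x≢u =
      integral-domain (λ e → 1≤⇒≢0 (1≤b x≢u v (~-sym v~x) (~-sym u~v)) e)
        (trans (ℤ.*-comm (b x u) (b w u)) (integral-domain nv first)) ,
      integral-domain (λ e → 1≤⇒≢0 (1≤b w≢v u (~-sym u~w) u~v) e) (integral-domain nu second)
      where
      0≤₁ : 0ℤ ≤ b v v * (b w u * b x u)
      0≤₁ = *-nonneg (b-nonneg v v) (*-nonneg (b-nonneg w u) (b-nonneg x u))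
      0≤₂ : 0ℤ ≤ b u u * (b w v * b x v)
      0≤₂ = *-nonneg (b-nonneg u u) (*-nonneg (b-nonneg w v) (b-nonneg x v))
      total : b v v * (b w u * b x u) + b u u * (b w v * b x v) ≡ 0ℤ
      total = trans (sym (orthogonal-coordinates buv≡0 w x))
        (trans (cong (b u u * b v v *_) (far u~w w≢v v~x x≢u)) (ℤ.*-zeroʳ (b u u * b v v)))
      first : b v v * (b w u * b x u) ≡ 0ℤ
      first = nonneg-sum-zero 0≤₁ 0≤₂ total
      second : b u u * (b w v * b x v) ≡ 0ℤ
      second = nonneg-sum-zero 0≤₂ 0≤₁ (trans (ℤ.+-comm _ (b v v * (b w u * b x u))) total)

    b-wu≡0 : ∀ w → u ~ w → w ≢ v → b w u ≡ 0ℤ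
    b-wu≡0 w u~w w≢v with other-neighbour u (2≤degree nv)
    ... | x , v~x , x≢u = proj₁ (vanish u~w w≢v v~x x≢u)

    b-wv≡0 : ∀ x → v ~ x → x ≢ u → b x v ≡ 0ℤ
    b-wv≡0 x v~x x≢u with other-neighbour v (2≤degree nu)
    ... | w , u~w , w≢v = proj₂ (vanish u~w w≢v v~x x≢u)

  module NoInducedC₄ (no-C₄ : ¬ HasInducedSubgraph G C₄) where
    module _ {u v} (u~v : u ~ v) (nu : NonNull u) (nv : NonNull v) (buv≡0 : b u v ≡ 0ℤ) where
      private
        no-common : ∀ {k} → u ~ k → ¬ k ~ v
        no-common {k} u~k k~v = 1≤⇒≢0 (1≤s k u~k k~v) (trans (sym (b-off (~⇒≢ u~v))) buv≡0)

      -- A common neighbour k of w and v other than u would give the 4-cycle u, w, k, v. It has no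
      -- chords because u and v have no common neighbour.
      b-wv≡1 : ∀ {w} → u ~ w → w ≢ v → b w v ≡ + 1
      b-wv≡1 {w} u~w w≢v = trans (b-off w≢v) (trans
        (sum-single (λ k → a w k * a k v) u λ k k≢u → decidable-stable (a w k * a k v ℤ.≟ 0ℤ) λ t≢0 →
          let w~k = a≢0⇒~ {w} {k} λ e → t≢0 (cong (_* a k v) e)
              k~v = a≢0⇒~ {k} {v} λ e → t≢0 (trans (cong (a w k *_) e) (ℤ.*-zeroʳ (a w k)))
          in no-C₄ (induced-C₄ u~w w~k k~v (~-sym u~v) (λ u~k → no-common u~k k~v) (no-common u~w) (k≢u ∘ sym) w≢v))
        (path≡1 (~-sym u~w) u~v))

      norm : ∀ {w} → u ~ w → w ≢ v → b u u * b v v * b w w ≡ b v v * (b w u * b w u) + b u u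
      norm {w} u~w w≢v = trans (orthogonal-coordinates buv≡0 w w)
        (trans (cong (λ x → b v v * (b w u * b w u) + b u u * (x * x)) (b-wv≡1 u~w w≢v))
          (cong (λ x → b v v * (b w u * b w u) + x) (ℤ.*-identityʳ (b u u))))

      -- Neither w nor v is adjacent to w, so at least two neighbours of u are not shared with w.
      b-wu<b-uu : ∀ {w} → u ~ w → w ≢ v → b w u + + 1 ≤ b u u
      b-wu<b-uu {w} u~w w≢v = subst (_≤ b u u) (cong (_+ + 1) (trans (sym (b-off (~⇒≢ u~w))) (b-sym u w)))
        (subst (s u w + + 1 ≤_) (sym (b-diag u))
          (0≤⇒≤ _ (≤⇒0≤ (two-neighbours-missed w≢v u~w (~-irrefl refl) u~v (λ v~w → no-common u~w (~-sym v~w))))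
            (lemma (s u u) (s u w))))
        where
        lemma : ∀ x y → x - + 1 - (y + + 1) ≡ x - y - + 2
        lemma = ℤRing.solve-∀

      -- Either some further neighbour of u adds nothing to `p u u`, or `p≥b` applies.
      isolated-or-large : (∃[ w ] (u ~ w × w ≢ v × b w u ≡ 0ℤ)) ⊎ b u u ≤ p u u
      isolated-or-large with any? (λ w → (u ~? w) ×-dec (¬? (w ≟ v) ×-dec (b w u ℤ.≟ 0ℤ)))
      ... | yes found = inj₁ found
      ... | no none   = inj₂ (p≥b buv≡0 λ w u~w w≢v e → none (w , u~w , w≢v , e))

      -- When w is orthogonal to u, `norm` reduces to |u|² |v|² |w|² = |u|², and the integers |v|²
      -- and |w|² have product one.
      isolated⇒b-vv≡1 : ∀ {w} → u ~ w → w ≢ v → b w u ≡ 0ℤ → b v v ≡ + 1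
      isolated⇒b-vv≡1 {w} u~w w≢v e = unit (b-nonneg v v) (b-nonneg w w) (*-cancel-≡ nu
        (trans (sym (ℤ.*-assoc (b u u) (b v v) (b w w))) (trans (norm u~w w≢v)
        (trans (cong (λ x → b v v * (x * x) + b u u) e) (lemma (b v v) (b u u))))))
        where
        lemma : ∀ x y → x * (0ℤ * 0ℤ) + y ≡ y * + 1
        lemma = ℤRing.solve-∀
        unit : ∀ {x y} → 0ℤ ≤ x → 0ℤ ≤ y → x * y ≡ + 1 → x ≡ + 1
        unit {+ x} {+ y} _ _ q = cong +_ (ℕ.m*n≡1⇒m≡1 x y (ℤ.+-injective (trans (ℤ.pos-* x y) q)))

      b-uu≡1⇒b-wu≡0 : b u u ≡ + 1 → ∀ w → u ~ w → w ≢ v → b w u ≡ 0ℤ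
      b-uu≡1⇒b-wu≡0 e w u~w w≢v = ℤ.≤-antisym (0≤⇒≤ _ (≤⇒0≤ (subst (b w u + + 1 ≤_) e (b-wu<b-uu u~w w≢v))) (lemma (b w u))) (b-nonneg w u)
        where
        lemma : ∀ x → 0ℤ - x ≡ + 1 - (x + + 1)
        lemma = ℤRing.solve-∀

      p-uu≡0 : b u u ≡ + 1 → p u u ≡ 0ℤ
      p-uu≡0 e = p≡0 buv≡0 (b-uu≡1⇒b-wu≡0 e)

      b-uu≡1⇒b-vv≡1 : b u u ≡ + 1 → b v v ≡ + 1
      b-uu≡1⇒b-vv≡1 e with other-neighbour v (2≤degree nu)
      ... | w , u~w , w≢v = isolated⇒b-vv≡1 u~w w≢v (b-uu≡1⇒b-wu≡0 e w u~w w≢v)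

    -- If `p≥b` holds at both ends, the left side of `orthogonal-trace` is at least twice the right
    -- side, which is positive. Otherwise one end has squared length one, hence so has the other;
    -- then `p u u` and `p v v` vanish, again against the trace.
    triangles : EdgesInTriangles
    triangles u v u~v nu nv buv≡0 = cases (isolated-or-large u~v nu nv buv≡0) (isolated-or-large v~u nv nu bvu≡0)
      where
      v~u = ~-sym u~v
      bvu≡0 = trans (b-sym v u) buv≡0
      units : b u u ≡ + 1 → b v v ≡ + 1 → ⊥
      units eu ev = trace-contradiction nu nv buv≡0 (p-uu≡0 u~v nu nv buv≡0 eu) (p-uu≡0 v~u nv nu bvu≡0 ev)
      unitᵥ : b v v ≡ + 1 → ⊥
      unitᵥ ev = units (b-uu≡1⇒b-vv≡1 v~u nv nu bvu≡0 ev) ev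
      cases : _ → _ → ⊥
      cases (inj₁ (w , u~w , w≢v , e)) _ = unitᵥ (isolated⇒b-vv≡1 u~v nu nv buv≡0 u~w w≢v e)
      cases _ (inj₁ (x , v~x , x≢u , e)) =
        unitᵥ (b-uu≡1⇒b-vv≡1 u~v nu nv buv≡0 (isolated⇒b-vv≡1 v~u nv nu bvu≡0 v~x x≢u e))
      cases (inj₂ hu) (inj₂ hv) = nv (integral-domain nu (nonneg-sum-zero
        (*-nonneg (b-nonneg u u) (b-nonneg v v))
        (+-nonneg (*-nonneg (b-nonneg v v) (≤⇒0≤ hu)) (*-nonneg (b-nonneg u u) (≤⇒0≤ hv)))
        (trans (lemma (b u u) (b v v) (p u u) (p v v))
          (ℤ.i≡j⇒i-j≡0 (orthogonal-trace buv≡0)))))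
        where
        lemma : ∀ x y z w → x * y + (y * (z - x) + x * (w - y)) ≡ y * z + x * w - x * y
        lemma = ℤRing.solve-∀

-- Finding the centre on an extreme ray

-- This characterises F n: the vertices other than y are then matched in pairs.
IsCenter : (G : Graph) → Graph.Vertex G → Set
IsCenter G y = ∀ z → z ≢ y → y ~ z × s y z ≡ + 1
  where
  open Graph G
  open Adjacency G

module Center (n : ℕ) (G : Graph) (facts : SpectralFacts n G) (m≢0 : + (n ℕ.* 2) ≢ 0ℤ)
  (u₀ v₀ : Graph.Vertex G) (1≤Δ : + 1 ≤ Geometry.Δ n G facts m≢0 u₀ v₀)
  (triangles : Triangles.EdgesInTriangles n G facts m≢0) where
  open Graph G
  open Geometry n G facts m≢0
  open Triangles n G facts m≢0 using (1≤b)

  0≤Δ : 0ℤ ≤ Δ u₀ v₀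
  0≤Δ = ℤ.≤-trans (+≤+ z≤n) 1≤Δ

  u₀∦v₀ : u₀ ∦ v₀
  u₀∦v₀ = 1≤⇒≢0 1≤Δ

  open Basis u₀ v₀ 0≤Δ u₀∦v₀ using (null; ∥-trans)

  u₀-nonNull : NonNull u₀
  u₀-nonNull e = u₀∦v₀ (cong₂ (λ x y → x * b v₀ v₀ - y * b v₀ u₀) e (null e v₀))

  v₀-nonNull : NonNull v₀
  v₀-nonNull e = u₀∦v₀ (trans (cong₂ (λ x y → b u₀ u₀ * x - b u₀ v₀ * y) e (null e u₀))
    (cong₂ _-_ (ℤ.*-zeroʳ (b u₀ u₀)) (ℤ.*-zeroʳ (b u₀ v₀))))

  ∥-refl : ∀ {u v} → u ≡ v → u ∥ v
  ∥-refl {u} refl = ℤ.+-inverseʳ (b u u * b u u)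

  -- A second neighbour w of u shares u with v, so w · v is positive, whereas a zero vector is
  -- orthogonal to everything.
  neighbour-nonNull : ∀ {u v} → u ~ v → NonNull u → NonNull v
  neighbour-nonNull {u} {v} u~v nu e with other-neighbour v (2≤degree nu)
  ... | w , u~w , w≢v = 1≤⇒≢0 (1≤b w≢v u (~-sym u~w) u~v) (trans (b-sym w v) (null e w))

  -- Every neighbour of u has positive inner product with u, so `p u u` is at least the degree |u|²
  -- + 1, and likewise for v. This exceeds what `orthogonal-trace` allows.
  b≢0 : ∀ {u v} → NonNull u → NonNull v → b u v ≢ 0ℤ
  b≢0 {u} {v} nu nv e = nu (nonneg-sum-zero (b-nonneg u u)
    (+-nonneg (b-nonneg v v) (+-nonneg (*-nonneg (b-nonneg u u) (b-nonneg v v))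
      (+-nonneg (*-nonneg (b-nonneg v v) (≤⇒0≤ (p≥degree nu))) (*-nonneg (b-nonneg u u) (≤⇒0≤ (p≥degree nv))))))
    (trans (lemma (b u u) (b v v) (p u u) (p v v))
      (ℤ.i≡j⇒i-j≡0 (orthogonal-trace e))))
    where
    lemma : ∀ x y z w → x + (y + (x * y + (y * (z - (x + + 1)) + x * (w - (y + + 1))))) ≡ y * z + x * w - x * y
    lemma = ℤRing.solve-∀
    p≥degree : ∀ {u} → NonNull u → b u u + + 1 ≤ p u u
    p≥degree {u} nu = subst (_≤ p u u) (degree≡ u) (sum-mono λ k → cases k (u ~? k))
      where
      cases : ∀ k → Dec (u ~ k) → a u k * a k u ≤ a u k * b k u
      cases k (no u≁k)  = ℤ.≤-reflexive (trans (cong (_* a k u) (a-no u≁k)) (sym (cong (_* b k u) (a-no u≁k))))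
      cases k (yes u~k) = subst (_≤ a u k * b k u) (sym (path≡1 u~k (~-sym u~k)))
        (subst (+ 1 ≤_) (sym (trans (cong (_* b k u) (a-yes u~k)) (ℤ.*-identityˡ (b k u))))
          (≢0⇒1≤ (b-nonneg k u) (triangles k u (~-sym u~k) (neighbour-nonNull u~k nu) nu)))

  s-a-nonneg : ∀ {u} → NonNull u → ∀ z → 0ℤ ≤ s u z - a u z
  s-a-nonneg {u} nu z = cases (u ~? z)
    where
    cases : Dec (u ~ z) → 0ℤ ≤ s u z - a u z
    cases (no u≁z)  = subst (0ℤ ≤_) (sym (trans (cong (s u z -_) (a-no u≁z)) (ℤ.+-identityʳ (s u z)))) (s-nonneg u z)
    cases (yes u~z) = subst (λ x → 0ℤ ≤ s u z - x) (sym (a-yes u~z)) (≤⇒0≤ (subst (+ 1 ≤_) (b-off (~⇒≢ u~z))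
      (≢0⇒1≤ (b-nonneg u z) (triangles u z u~z nu (neighbour-nonNull u~z nu)))))

  s-a-combination : ∀ u x → sum (λ z → (s u z - a u z) * b z x) ≡ m * b u x
  s-a-combination u x = trans (sum-cong λ z → lemma (s u z) (a u z) (b z x))
    (trans (sum-minus (λ z → s u z * b z x) (λ z → a u z * b z x))
    (trans (cong (_- p u x) (s⊗b u x)) (lemma′ (p u x) (m * b u x))))
    where
    lemma : ∀ x y z → (x - y) * z ≡ x * z - y * z
    lemma = ℤRing.solve-∀
    lemma′ : ∀ x y → x + y - x ≡ y
    lemma′ = ℤRing.solve-∀

  -- Extremality makes the coefficient of z in the combination for m u vanish, so `s u z` equals
  -- `a u z`. Their common value is nonzero because u and z are not orthogonal.
  extreme-adjacent : ∀ {u z} → Extreme u → NonNull u → NonNull z → z ∦ u → u ~ z × s u z ≡ + 1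
  extreme-adjacent {u} {z} ext nu nz z∦u = u~z , trans s≡a (a-yes u~z)
    where
    s≡a : s u z ≡ a u z
    s≡a = ℤ.i-j≡0⇒i≡j (s u z) (a u z) (decidable-stable (s u z - a u z ℤ.≟ 0ℤ) λ w≢0 →
      z∦u (ext (λ z → s u z - a u z) m (s-a-nonneg nu) (s-a-combination u) z w≢0))
    u~z : u ~ z
    u~z = a≢0⇒~ λ a≡0 → b≢0 nu nz (trans (b-off λ u≡z → z∦u (∥-refl (sym u≡z))) (trans s≡a a≡0))

  ExtremeRay : Vertex → Set
  ExtremeRay x = ∀ z → NonNull z → z ∥ x → Extreme z

  module _ {x y : Vertex} (nx : NonNull x) (ny : NonNull y) (x∦y : x ∦ y)
           (extx : ExtremeRay x) (exty : ExtremeRay y) where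

    private
      x~y×s≡1 : x ~ y × s x y ≡ + 1
      x~y×s≡1 = extreme-adjacent (extx x nx (∥-refl refl)) nx ny (x∦y ∘ ∥-sym {y} {x})

      x~y : x ~ y
      x~y = proj₁ x~y×s≡1

    -- A neighbour k of x that is neither y nor adjacent to y must lie on the ray of y, and is then
    -- adjacent to t. So k and y are both common neighbours of x and t, which have only one.
    interior⇒dominated : ∀ {t} → x ~ t → t ~ y → t ∦ x → t ∦ y → ∀ k → x ~ k → k ≢ y → k ~ y
    interior⇒dominated {t} x~t t~y t∦x t∦y k x~k k≢y = decidable-stable (k ~? y) λ k≁y →
      let nk  = neighbour-nonNull x~k nx
          nt  = neighbour-nonNull x~t nx
          k∥y = decidable-stable (Δ k y ℤ.≟ 0ℤ) λ k∦y →
                  k≁y (~-sym (proj₁ (extreme-adjacent (exty y ny (∥-refl refl)) ny nk k∦y)))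
          t∦k = λ t∥k → t∦y (∥-trans {t} {k} {y} nk t∥k k∥y)
          k~t = proj₁ (extreme-adjacent (exty k nk k∥y) nk nt t∦k)
          sxt = proj₂ (extreme-adjacent (extx x nx (∥-refl refl)) nx nt t∦x)
      in k≢y (common-neighbour-unique sxt x~k k~t x~y (~-sym t~y))

    module _ {t} (x~t : x ~ t) (t~y : t ~ y) (t∥x : t ∥ x) where
      private
        nt : NonNull t
        nt = neighbour-nonNull x~t nx

        across : ∀ {u v} → NonNull u → u ∥ x → NonNull v → v ∥ y → u ~ v × s u v ≡ + 1
        across {u} {v} nu u∥x nv v∥y = extreme-adjacent (extx u nu u∥x) nu nv λ v∥u →
          x∦y (∥-trans {x} {u} {y} nu (∥-sym {u} {x} u∥x) (∥-trans {u} {v} {y} nv (∥-sym {v} {u} v∥u) v∥y))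

        -- If k and v were adjacent and both on the ray of y, then k and t would be common
        -- neighbours of x and v. As these have only one, k = t, but t lies on the ray of x.
        independent : ∀ {k v} → NonNull v → v ∥ y → k ~ v → k ∦ y
        independent {k} {v} nv v∥y k~v k∥y = x∦y (∥-trans {x} {k} {y} nk (subst (x ∥_) (sym k≡t) (∥-sym {t} {x} t∥x)) k∥y)
          where
          nk : NonNull k
          nk = neighbour-nonNull (~-sym k~v) nv
          k≡t : k ≡ t
          k≡t = common-neighbour-unique (proj₂ (across nx (∥-refl refl) nv v∥y))
            (proj₁ (across nx (∥-refl refl) nk k∥y)) k~v x~t (proj₁ (across nt t∥x nv v∥y))

        -- By `independent`, the neighbours of v lie off the ray of y, and the extreme vertex v′ is
        -- adjacent to all nonzero vectors off its ray.
        neighbours-shared : ∀ {v v′} → NonNull v → v ∥ y → NonNull v′ → v′ ∥ y → ∀ k → v ~ k → k ~ v′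
        neighbours-shared {v} {v′} nv v∥y nv′ v′∥y k v~k = ~-sym (proj₁ (extreme-adjacent (exty v′ nv′ v′∥y) nv′ nk λ k∥v′ →
          independent nv v∥y (~-sym v~k) (∥-trans {k} {v′} {y} nv′ k∥v′ v′∥y)))
          where
          nk : NonNull k
          nk = neighbour-nonNull v~k nv

        -- Two vertices on the ray of y share all neighbours, so v · y would be both |v|² + 1 and
        -- |y|² + 1. The Gram determinant would then be negative, but parallel vectors have
        -- determinant zero.
        alone : ∀ {v} → NonNull v → v ∥ y → v ≡ y
        alone {v} nv v∥y = decidable-stable (v ≟ y) λ v≢y →
          contradiction (nonneg-sum-zero (+≤+ z≤n) (+-nonneg (b-nonneg v v) (b-nonneg y y)) (defect v≢y)) λ ()
          where
          b≡degree : ∀ {u w} → u ≢ w → (∀ k → u ~ k → k ~ w) → b u w ≡ b u u + + 1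
          b≡degree {u} u≢w u⊆w = trans (b-off u≢w) (trans (neighbours-⊆ u⊆w) (degree≡ u))
          lemma : ∀ x y → + 1 + (x + y) ≡ 0ℤ - (x * y - (x + + 1) * (y + + 1))
          lemma = ℤRing.solve-∀
          defect : v ≢ y → + 1 + (b v v + b y y) ≡ 0ℤ
          defect v≢y = trans (lemma (b v v) (b y y)) (cong (0ℤ -_) (trans
            (sym (cong₂ (λ s t → b v v * b y y - s * t)
              (b≡degree v≢y (neighbours-shared nv v∥y ny (∥-refl refl)))
              (b≡degree (v≢y ∘ sym) (neighbours-shared ny (∥-refl refl) nv v∥y))))
            v∥y))

        adjacent : ∀ {z} → NonNull z → z ≢ y → y ~ z × s y z ≡ + 1
        adjacent nz z≢y = extreme-adjacent (exty y ny (∥-refl refl)) ny nz λ z∥y → z≢y (alone nz z∥y)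

        -- In the combination for m y only the term of y survives. Its coefficient is the degree of
        -- y.
        degree : s y y ≡ m
        degree = *-cancel-≡ ny (trans (ℤ.*-comm (b y y) (s y y)) (trans (sym single)
          (trans (s-a-combination y y) (ℤ.*-comm m (b y y)))))
          where
          term : Vertex → ℤ
          term z = (s y z - a y z) * b z y
          other : ∀ z → z ≢ y → term z ≡ 0ℤ
          other z z≢y = cases (b z z ℤ.≟ 0ℤ)
            where
            cases : Dec (b z z ≡ 0ℤ) → term z ≡ 0ℤ
            cases (yes e) = trans (cong ((s y z - a y z) *_) (null e y)) (ℤ.*-zeroʳ (s y z - a y z))
            cases (no nz) = cong (_* b z y) (cong₂ _-_ (proj₂ (adjacent nz z≢y)) (a-yes (proj₁ (adjacent nz z≢y))))
          single : sum term ≡ s y y * b y y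
          single = trans (sum-single term y other) (cong (_* b y y)
            (trans (cong (s y y -_) (a-no (~-irrefl refl))) (ℤ.+-identityʳ (s y y))))

      isCenter : IsCenter G y
      isCenter z z≢y = adjacent (neighbour-nonNull (full-degree degree z z≢y) ny) z≢y

  -- The extreme vertices x and y have a single common neighbour t. If t lies on one of the two
  -- rays, the other ray carries the centre. If it lies on neither, x and y dominate each other, so
  -- x · y = |x|² = |y|² and they would be parallel.
  center-from-rays : ∀ {x y} → NonNull x → NonNull y → x ∦ y → ExtremeRay x → ExtremeRay y → ∃[ c ] IsCenter G c
  center-from-rays {x} {y} nx ny x∦y extx exty = cases (Δ t x ℤ.≟ 0ℤ) (Δ t y ℤ.≟ 0ℤ)
    where
    y∦x : y ∦ x
    y∦x = x∦y ∘ ∥-sym {y} {x}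
    x~y×s≡1 : x ~ y × s x y ≡ + 1
    x~y×s≡1 = extreme-adjacent (extx x nx (∥-refl refl)) nx ny y∦x
    x~y = proj₁ x~y×s≡1
    common : ∃[ t ] (x ~ t × t ~ y)
    common = common-neighbour λ s≡0 → contradiction (trans (sym (proj₂ x~y×s≡1)) s≡0) λ ()
    t = proj₁ common
    x~t = proj₁ (proj₂ common)
    t~y = proj₂ (proj₂ common)
    cases : Dec (t ∥ x) → Dec (t ∥ y) → ∃[ c ] IsCenter G c
    cases (yes t∥x) _ = y , isCenter nx ny x∦y extx exty x~t t~y t∥x
    cases _ (yes t∥y) = x , isCenter ny nx y∦x exty extx (~-sym t~y) (~-sym x~t) t∥y
    cases (no t∦x) (no t∦y) = contradiction (trans
      (cong₂ (λ s t → b x x * b y y - s * t)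
        (dominated x~y (interior⇒dominated nx ny x∦y extx exty x~t t~y t∦x t∦y))
        (dominated (~-sym x~y) (interior⇒dominated ny nx y∦x exty extx (~-sym t~y) (~-sym x~t) t∦y t∦x)))
      (ℤ.+-inverseʳ (b x x * b y y))) x∦y

  center : ∃[ c ] IsCenter G c
  center =
    let x , y , nx , ny , x∦y , extx , exty = extreme-rays u₀ v₀ 0≤Δ u₀∦v₀ u₀-nonNull v₀-nonNull
    in center-from-rays {x} {y} nx ny x∦y extx exty

-- The case n = 1

module _ (G : Graph) where
  open Graph G
  open Counting G

  -- The Gram vectors span only a line here, so there are no two extreme rays. On three vertices
  -- each `b u u` is at most one, and `tr-b` gives their sum as three. So `G` is a triangle, in
  -- which any vertex is a centre.
  center₁ : SpectralFacts 1 G → ∃[ c ] IsCenter G c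
  center₁ facts = y , λ z z≢y → all-adjacent y z z≢y , trans (sym (b-off (z≢y ∘ sym)))
    (trans (dominated (all-adjacent y z z≢y) λ k _ k≢z → ~-sym (all-adjacent z k k≢z)) (b≡1 y))
    where
    open Geometry 1 G facts (λ ()) using (full-degree; dominated; order≡; tr-b)
    y : Vertex
    y = subst Fin (sym order≡) zero

    path≤1 : ∀ u k → a u k * a k u ≤ + 1
    path≤1 u k = cases (u ~? k)
      where
      cases : Dec (u ~ k) → a u k * a k u ≤ + 1
      cases (yes u~k) = ℤ.≤-reflexive (path≡1 u~k (~-sym u~k))
      cases (no u≁k)  = subst (_≤ + 1) (sym (cong (_* a k u) (a-no u≁k))) (+≤+ z≤n)

    order-sum : sum {order} (λ _ → + 1) ≡ + 3
    order-sum = trans (sum-const order (+ 1)) (trans (ℤ.*-identityʳ (+ order)) (cong +_ order≡))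

    degree≤2 : ∀ u → b u u ≤ + 1
    degree≤2 u = subst (_≤ + 1) (sym (b-diag u)) (0≤⇒≤ _ (≤⇒0≤ 1≤gap) (lemma (s u u)))
      where
      lemma : ∀ x → + 1 - (x - + 1) ≡ (+ 3 - x) - + 1
      lemma = ℤRing.solve-∀
      gaps : Vertex → ℤ
      gaps k = + 1 - a u k * a k u
      0≤gaps : ∀ k → 0ℤ ≤ gaps k
      0≤gaps k = ≤⇒0≤ (path≤1 u k)
      1≤gap : + 1 ≤ + 3 - s u u
      1≤gap = subst (+ 1 ≤_) (trans (sum-minus (λ _ → + 1) (λ k → a u k * a k u)) (cong (_- s u u) order-sum))
        (≢0⇒1≤ (sum-nonneg 0≤gaps) λ e → contradiction
          (trans (sym (cong (λ x → + 1 - x * a u u) (a-no (~-irrefl refl)))) (sum≡0⇒term≡0 0≤gaps e u)) λ ())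

    b≡1 : ∀ u → b u u ≡ + 1
    b≡1 u = sym (ℤ.i-j≡0⇒i≡j (+ 1) (b u u) (sum≡0⇒term≡0 (λ u → ≤⇒0≤ (degree≤2 u))
      (trans (sum-minus (λ _ → + 1) (λ u → b u u)) (cong₂ _-_ order-sum tr-b)) u))

    all-adjacent : ∀ u v → v ≢ u → u ~ v
    all-adjacent u = full-degree {u} (ℤ.i-j≡0⇒i≡j (s u u) (+ 2) (trans (lemma (s u u)) (ℤ.i≡j⇒i-j≡0 (trans (sym (b-diag u)) (b≡1 u)))))
      where
      lemma : ∀ x → x - + 2 ≡ x - + 1 - + 1
      lemma = ℤRing.solve-∀

-- Two independent Gram vectors for n at least two

module _ (n : ℕ) (G : Graph) (facts : SpectralFacts (suc (suc n)) G) where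
  open Geometry (suc (suc n)) G facts (λ ())

  private
    x : ℤ
    x = + (n ℕ.* 2)

    -- The Gram determinants add up to (tr b)² - tr b² = 2m (m - 2). Here m = 4 + x, which gives a
    -- polynomial in x with nonnegative coefficients and a positive constant term.
    total : sum (λ u → sum (λ v → Δ u v)) ≡ + 16 + + 12 * x + + 2 * (x * x)
    total = trans (sum-cong λ u → trans (sum-minus (λ v → b u u * b v v) (λ v → b u v * b v u))
                                        (cong (_- (b ⊗ᶻ b) u u) (sym (*-distribˡ-sum (b u u) λ v → b v v))))
      (trans (sum-minus (λ u → b u u * tr b) (λ u → (b ⊗ᶻ b) u u))
      (trans (cong (_- tr (b ⊗ᶻ b)) (sym (*-distribʳ-sum (tr b) λ u → b u u)))
      (trans (cong₂ (λ s t → s * s - t) tr-b tr-b²) (lemma x))))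
      where
      lemma : ∀ x → ((+ 4 + x) - + 1 + (+ 4 + x)) * ((+ 4 + x) - + 1 + (+ 4 + x)) - (+ 2 * (+ 4 + x) * (+ 4 + x) + + 1) ≡ + 16 + + 12 * x + + 2 * (x * x)
      lemma = ℤRing.solve-∀

    1≤total : + 1 ≤ sum (λ u → sum (λ v → Δ u v))
    1≤total = subst (+ 1 ≤_) (sym total) (0≤⇒≤ (+ 15 + (+ 12 * x + + 2 * (x * x)))
      (+-nonneg (+≤+ z≤n) (+-nonneg (*-nonneg {+ 12} {x} (+≤+ z≤n) (+≤+ z≤n)) (*-nonneg {+ 2} (+≤+ z≤n) (square-nonneg x)))) (lemma x))
      where
      lemma : ∀ x → + 16 + + 12 * x + + 2 * (x * x) - + 1 ≡ + 15 + (+ 12 * x + + 2 * (x * x))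
      lemma = ℤRing.solve-∀

  positive-minor : ∃[ u ] ∃[ v ] + 1 ≤ Δ u v
  positive-minor =
    let u , 1≤row = positive-term (λ u → sum (λ v → Δ u v)) 1≤total
        v , 1≤Δ   = positive-term (λ v → Δ u v) 1≤row
    in u , v , 1≤Δ

center-exists : ∀ n G (facts : SpectralFacts (suc n) G) → Triangles.EdgesInTriangles (suc n) G facts (λ ()) →
                ∃[ c ] IsCenter G c
center-exists zero    G facts _         = center₁ G facts
center-exists (suc n) G facts triangles =
  let u , v , 1≤Δ = positive-minor n G facts in Center.center (suc (suc n)) G facts (λ ()) u v 1≤Δ triangles

-- Rebuilding the friendship graph around a centre

missed-value : ∀ {m n} (f : Fin m → Fin n) → m ℕ.< n → ∃[ x ] ∀ i → f i ≢ x
missed-value f m<n = decidable-stable (any? λ x → all? λ i → ¬? (f i ≟ x)) λ none →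
  let hit : ∀ x → ∃[ i ] f i ≡ x
      hit x = decidable-stable (any? λ i → f i ≟ x) λ missed → none (x , λ i e → missed (i , e))
  in ℕ.<⇒≱ m<n (injective⇒≤ {f = proj₁ ∘ hit} λ {x} {y} e →
       trans (sym (proj₂ (hit x))) (trans (cong f e) (proj₂ (hit y))))

-- A missed value could be added as one more image, giving an injection from a set that is too
-- large.
injective⇒hit : ∀ {m n} (f : Fin m → Fin n) → Injective _≡_ _≡_ f → n ℕ.≤ m → ∀ x → ∃[ i ] f i ≡ x
injective⇒hit {m} {n} f inj n≤m x = decidable-stable (any? λ i → f i ≟ x) λ missed →
  ℕ.<⇒≱ (s≤s n≤m) (injective⇒≤ {f = extended} (extended-injective missed))
  where
  extended : Fin (suc m) → Fin n
  extended zero    = x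
  extended (suc i) = f i
  extended-injective : ¬ (∃[ i ] f i ≡ x) → Injective _≡_ _≡_ extended
  extended-injective missed {zero}  {zero}  _ = refl
  extended-injective missed {zero}  {suc j} e = contradiction (j , sym e) missed
  extended-injective missed {suc i} {zero}  e = contradiction (i , e) missed
  extended-injective missed {suc i} {suc j} e = cong suc (inj e)

module _ (n : ℕ) (G : Graph) (order≡ : Graph.order G ≡ suc (n ℕ.* 2))
         (y : Graph.Vertex G) (center : IsCenter G y) where
  open Graph G
  open Counting G

  private
    module _ {z} (z≢y : z ≢ y) where
      common : ∃[ t ] (y ~ t × t ~ z)
      common = common-neighbour λ s≡0 → contradiction (trans (sym (proj₂ (center z z≢y))) s≡0) λ ()

      unique : ∀ {t t′} → t ≢ y → t ~ z → t′ ≢ y → t′ ~ z → t ≡ t′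
      unique t≢y t~z t′≢y t′~z = common-neighbour-unique (proj₂ (center z z≢y))
        (proj₁ (center _ t≢y)) t~z (proj₁ (center _ t′≢y)) t′~z

    -- k triangles through y, disjoint otherwise, with their leaves numbered as in `F k`.
    record Matching (k : ℕ) : Set where
      field
        leaf           : Fin (k ℕ.* 2) → Vertex
        leaf-injective : Injective _≡_ _≡_ leaf
        leaf≢y         : ∀ i → leaf i ≢ y
        leaf-twin      : ∀ i → leaf i ~ leaf (twin {k} i)

      vertex : Fin (suc (k ℕ.* 2)) → Vertex
      vertex zero    = y
      vertex (suc i) = leaf i

      vertex-injective : Injective _≡_ _≡_ vertex
      vertex-injective {zero}  {zero}  _ = refl
      vertex-injective {zero}  {suc j} e = contradiction (sym e) (leaf≢y j)
      vertex-injective {suc i} {zero}  e = contradiction e (leaf≢y i)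
      vertex-injective {suc i} {suc j} e = cong suc (leaf-injective e)

    -- A vertex x not yet used is joined with the common neighbour t of x and y. If t were an old
    -- leaf, its twin and x would both be neighbours of t other than y, hence equal, although x is
    -- new.
    extend : ∀ {k} → k ℕ.< n → Matching k → Matching (suc k)
    extend {k} k<n M = record
      { leaf = leaf′ ; leaf-injective = injective′ _ _ ; leaf≢y = leaf′≢y ; leaf-twin = leaf′-twin }
      where
      open Matching M
      new : ∃[ x ] ∀ i → vertex i ≢ x
      new = missed-value vertex (subst (suc (k ℕ.* 2) ℕ.<_) (sym order≡) (s≤s (ℕ.*-monoˡ-< 2 k<n)))
      x : Vertex
      x = proj₁ new
      x≢y : x ≢ y
      x≢y = proj₂ new zero ∘ sym
      leaf≢x : ∀ i → leaf i ≢ x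
      leaf≢x i = proj₂ new (suc i)
      t : Vertex
      t = proj₁ (common x≢y)
      t≢y : t ≢ y
      t≢y t≡y = ~⇒≢ (proj₁ (proj₂ (common x≢y))) (sym t≡y)
      t~x : t ~ x
      t~x = proj₂ (proj₂ (common x≢y))
      leaf≢t : ∀ i → leaf i ≢ t
      leaf≢t i e = leaf≢x (twin {k} i) (unique t≢y (leaf≢y _) (subst (leaf (twin {k} i) ~_) e (~-sym (leaf-twin i))) x≢y (~-sym t~x))

      leaf′ : Fin (suc k ℕ.* 2) → Vertex
      leaf′ zero          = x
      leaf′ (suc zero)    = t
      leaf′ (suc (suc i)) = leaf i
      leaf′≢y : ∀ i → leaf′ i ≢ y
      leaf′≢y zero          = x≢y
      leaf′≢y (suc zero)    = t≢y
      leaf′≢y (suc (suc i)) = leaf≢y i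
      leaf′-twin : ∀ i → leaf′ i ~ leaf′ (twin {suc k} i)
      leaf′-twin zero          = ~-sym t~x
      leaf′-twin (suc zero)    = t~x
      leaf′-twin (suc (suc i)) = leaf-twin i
      injective′ : ∀ i j → leaf′ i ≡ leaf′ j → i ≡ j
      injective′ zero          zero          _ = refl
      injective′ zero          (suc zero)    e = contradiction (sym e) (~⇒≢ t~x)
      injective′ zero          (suc (suc j)) e = contradiction (sym e) (leaf≢x j)
      injective′ (suc zero)    zero          e = contradiction e (~⇒≢ t~x)
      injective′ (suc zero)    (suc zero)    _ = refl
      injective′ (suc zero)    (suc (suc j)) e = contradiction (sym e) (leaf≢t j)
      injective′ (suc (suc i)) zero          e = contradiction e (leaf≢x i)
      injective′ (suc (suc i)) (suc zero)    e = contradiction e (leaf≢t i)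
      injective′ (suc (suc i)) (suc (suc j)) e = cong (λ k → suc (suc k)) (leaf-injective e)

    matching : ∀ k → k ℕ.≤ n → Matching k
    matching zero    _   = record { leaf = λ () ; leaf-injective = λ { {()} } ; leaf≢y = λ () ; leaf-twin = λ () }
    matching (suc k) k<n = extend k<n (matching k (ℕ.<⇒≤ k<n))

  -- The n triangles exhaust the vertices by counting. There are no further edges, since a leaf has
  -- exactly one neighbour besides y, namely its twin.
  center⇒≅F : G ≅ F n
  center⇒≅F = mk↔ₛ′ index vertex (λ i → vertex-injective (vertex-index (vertex i))) vertex-index ,
    λ u v → mk⇔
      (λ u~v → reflects (index u) (index v) (subst₂ _~_ (sym (vertex-index u)) (sym (vertex-index v)) u~v))
      (λ e → subst₂ _~_ (vertex-index u) (vertex-index v) (preserves (index u) (index v) e))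
    where
    open Matching (matching n ℕ.≤-refl)
    hit : ∀ v → ∃[ i ] vertex i ≡ v
    hit = injective⇒hit vertex vertex-injective (ℕ.≤-reflexive order≡)
    index : Vertex → Fin (suc (n ℕ.* 2))
    index v = proj₁ (hit v)
    vertex-index : ∀ v → vertex (index v) ≡ v
    vertex-index v = proj₂ (hit v)
    module Fₙ = Graph (F n)
    preserves : ∀ i j → i Fₙ.~ j → vertex i ~ vertex j
    preserves zero    (suc j) _ = proj₁ (center (leaf j) (leaf≢y j))
    preserves (suc i) zero    _ = ~-sym (proj₁ (center (leaf i) (leaf≢y i)))
    preserves (suc i) (suc j) (i≢j , e) = subst (λ k → leaf i ~ leaf k) (sym (quotient-injective {n} i j i≢j e)) (leaf-twin i)
    reflects : ∀ i j → vertex i ~ vertex j → i Fₙ.~ j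
    reflects zero    zero    e = ~-irrefl refl e
    reflects zero    (suc j) _ = tt
    reflects (suc i) zero    _ = tt
    reflects (suc i) (suc j) e = subst (λ k → suc i Fₙ.~ suc k) (sym j≡twin) (twin-≢ {n} i , quotient-twin {n} i)
      where
      j≡twin : j ≡ twin {n} i
      j≡twin = leaf-injective (unique (leaf≢y i) (leaf≢y j) (~-sym e) (leaf≢y _) (~-sym (leaf-twin i)))

mainTheorem2 : ∀ {c ℓ₁ ℓ₂} (K : HeytingField c ℓ₁ ℓ₂) → CharacteristicZero K →
    (n : ℕ) → .{{_ : NonZero n}} → (G : Graph) → Cospectral K G (F n) →
    (¬ HasSubgraph G C₄ ⊎ ¬ HasSubgraph G C₅ → G ≅ F n) ×
    (¬ HasSubgraph G C₄ ⊎ ¬ HasInducedSubgraph G C₄ → G ≅ F n)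
mainTheorem2 K char0 (suc n) G cospectral =
  [ no-C₄ , iso ∘ no-C₅⇒triangles ] , [ no-C₄ , iso ∘ NoInducedC₄.triangles ]
  where
  facts : SpectralFacts (suc n) G
  facts = spectralFacts K char0 (suc n) G cospectral
  open Triangles (suc n) G facts (λ ())

  iso : EdgesInTriangles → G ≅ F (suc n)
  iso triangles = let y , isCenter = center-exists n G facts triangles in
    center⇒≅F (suc n) G (SpectralFacts.order≡ facts) y isCenter

  -- An induced 4-cycle is in particular a 4-cycle, so this alternative reduces to the absence of
  -- induced ones.
  no-C₄ : ¬ HasSubgraph G C₄ → G ≅ F (suc n)
  no-C₄ C₄-free = iso (NoInducedC₄.triangles λ (f , injective , edges) →
    C₄-free (f , injective , λ u v → Equivalence.to (edges u v)))
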